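{- Let $w_1,w_2$ be any odd positive integers, let $n\ge 0$ be an integer and let $y_1\in\mathbb{Z}_p$. Then the following eight expressions are all equal: \begin{align*} &\sum_{k=0}^{n}\binom{n}{k}E_{k,q^{w_2}}(w_1y_1)\,T_{n-k,q^{w_1}}(w_2-1)\,w_1^{n-k}w_2^{k}\\ =&\sum_{k=0}^{n}\binom{n}{k}E_{k,q^{w_1}}(w_2y_1)\,T_{n-k,q^{w_2}}(w_1-1)\,w_2^{n-k}w_1^{k}\\ =&\,w_1^{n}\sum_{i=0}^{w_1-1}(-1)^{i}q^{w_2 i}E_{n,q^{w_1}}\Big(w_2y_1+\frac{w_2}{w_1}i\Big)\\ =&\,w_2^{n}\sum_{i=0}^{w_2-1}(-1)^{i}q^{w_1 i}E_{n,q^{w_2}}\Big(w_1y_1+\frac{w_1}{w_2}i\Big)\\ =&\sum_{k+l+m=n}\binom{n}{k,l,m}E_{k,q^{w_1w_2}}(y_1)\,T_{l,q^{w_2}}(w_1-1)\,T_{m,q^{w_1}}(w_2-1)\,w_1^{k+m}w_2^{k+l}\\ =&\,w_1^{n}\sum_{k=0}^{n}\binom{n}{k}T_{n-k,q^{w_1}}(w_2-1)\,w_2^{k}\sum_{i=0}^{w_1-1}(-1)^{i}q^{w_2 i}E_{k,q^{w_1w_2}}\Big(y_1+\frac{i}{w_1}\Big)\\ =&\,w_2^{n}\sum_{k=0}^{n}\binom{n}{k}T_{n-k,q^{w_2}}(w_1-1)\,w_1^{k}\sum_{i=0}^{w_2-1}(-1)^{i}q^{w_1 i}E_{k,q^{w_1w_2}}\Big(y_1+\frac{i}{w_2}\Big)\\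 =&\,(w_1w_2)^{n}\sum_{i=0}^{w_1-1}\sum_{j=0}^{w_2-1}(-1)^{i+j}q^{w_2i+w_1j}E_{n,q^{w_1w_2}}\Big(y_1+\frac{i}{w_1}+\frac{j}{w_2}\Big). \end{align*}
   Context: Let $p$ be a fixed odd prime, $\mathbb{C}_p$ the completion of an algebraic closure of $\mathbb{Q}_p$ with absolute value normalized by $|p|_p=1/p$, and let $q\in\mathbb{C}_p$ be fixed with $|q-1|_p<p^{ -1/(p-1)}$. For $r\in\mathbb{C}_p$ with $|r-1|_p<p^{ -1/(p-1)}$ (in particular for $r=q^w$, $w$ a positive integer), the $r$-Euler polynomials $E_{n,r}(x)$ ($n\ge 0$) are the polynomials in $x$ defined by the generating function $$\frac{2}{re^{t}+1}e^{xt}=\sum_{n=0}^{\infty}E_{n,r}(x)\frac{t^n}{n!}.$$ For integers $k,N\ge 0$, the $r$-analogue of the alternating power sum is $T_{k,r}(N)=\sum_{i=0}^{N}(-1)^i i^k r^i$, with the convention $0^0=1$. Sums over $k+l+m=n$ run over all nonnegative integers $k,l,m$ with $k+l+m=n$, and $\binom{n}{k,l,m}=\frac{n!}{k!\,l!\,m!}$. -}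

module Defs where

open import Algebra.Apartness.Bundles using (HeytingField; HeytingCommutativeRing)
open import Algebra.Bundles using (CommutativeRing; RawRing)
open import Algebra.Morphism.Structures using (IsRingHomomorphism)
import Algebra.Definitions.RawSemiring as RawSemiringDefs
open import Data.Bool.Base using (if_then_else_)
open import Data.Fin.Base using (Fin; toℕ)
open import Data.Integer.Base as ℤ using (+_; -[1+_])
open import Data.Nat.Base as ℕ using (ℕ; zero; suc; 2+; _∸_; _!; NonTrivial)
open import Data.Nat.Divisibility using (_∣_; _∣?_)
open import Data.Product.Base using (Σ-syntax; ∃; ∃-syntax; _×_; _,_; proj₁)
open import Data.Rational.Base as ℚ using (ℚ; 0ℚ; mkℚ)
open import Data.Vec.Base using (Vec; []; _∷_; head; lookup)
open import Function.Base using (_∘_; case_of_)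
open import Level using (Level; _⊔_) renaming (suc to lsuc)
open import Relation.Binary.PropositionalEquality as ≡ using (_≡_; _≢_)
open import Relation.Nullary using (¬_; does)
open import Relation.Nullary.Construct.Add.Infimum using (_₋; ⊥₋; [_])
import Relation.Binary.Construct.Add.Infimum.NonStrict as AddInfimum≤
import Relation.Binary.Construct.Add.Infimum.Strict as AddInfimum<

private variable
  c ℓ₁ ℓ₂ : Level

Odd : ℕ → Set
Odd n = ¬ (2 ∣ n)

-- The set {0} ∪ { pʳ : r ∈ ℚ } of real numbers, which contains every value
-- of |·|ₚ on ℂₚ.  The exponent r is stored; p itself is left implicit, and
-- the order is that of the exponents because p > 1.

Magnitude : Set
Magnitude = ℚ ₋

pattern 𝟎    = ⊥₋
pattern p^ r = [ r ]

open AddInfimum≤ ℚ._≤_ public using () renaming (_≤₋_ to _≤ᴹ_)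
open AddInfimum< ℚ._<_ public using () renaming (_<₋_ to _<ᴹ_)

infixl 7 _·ᴹ_
infixl 6 _⊔ᴹ_

_·ᴹ_ : Magnitude → Magnitude → Magnitude
𝟎    ·ᴹ _    = 𝟎
p^ _ ·ᴹ 𝟎    = 𝟎
p^ r ·ᴹ p^ s = p^ (r ℚ.+ s)

_⊔ᴹ_ : Magnitude → Magnitude → Magnitude
𝟎    ⊔ᴹ m    = m
p^ r ⊔ᴹ 𝟎    = p^ r
p^ r ⊔ᴹ p^ s = p^ (r ℚ.⊔ s)

-- p^(-1/(p-1))
radius : (p : ℕ) → .{{NonTrivial p}} → Magnitude
radius (2+ k) = p^ (-[1+ 0 ] ℚ./ suc k)

-- The largest k ≤ b with pᵏ ∣ n.
maxPower : (p n b : ℕ) → ℕ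
maxPower p n zero    = 0
maxPower p n (suc b) = if does (p ℕ.^ suc b ∣? n) then suc b else maxPower p n b

-- For n > 0 and p > 1, pᵏ ∣ n forces k ≤ n, so the bound n is no restriction.
ord : (p n : ℕ) → ℕ
ord p n = maxPower p n n

-- |a/b|ₚ = p^(ordₚ b - ordₚ a)
padicAbs : ℕ → ℚ → Magnitude
padicAbs p (mkℚ (+ 0) _ _) = 𝟎
padicAbs p x@(mkℚ _ _ _)   =
  p^ ((+ ord p (ℚ.denominatorℕ x) ℤ.- + ord p ℤ.∣ ℚ.numerator x ∣) ℚ./ 1)

-- A field with a nonarchimedean absolute value.  In a Heyting field "x # 0"
-- is the positive form of "x ≠ 0"; as # is tight, `definite` contains
-- |x| = 0 ⇔ x ≈ 0.

record ValuedField c ℓ₁ ℓ₂ : Set (lsuc (c ⊔ ℓ₁ ⊔ ℓ₂)) where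
  field
    heytingField : HeytingField c ℓ₁ ℓ₂

  open HeytingField heytingField public
  open HeytingCommutativeRing heytingCommutativeRing public using (commutativeRing)
  open CommutativeRing commutativeRing public using (rawRing)

  field
    ∣_∣         : Carrier → Magnitude
    ∣∣-cong     : ∀ {x y} → x ≈ y → ∣ x ∣ ≡ ∣ y ∣
    definite    : ∀ {x} → (∣ x ∣ ≢ 𝟎 → x # 0#) × (x # 0# → ∣ x ∣ ≢ 𝟎)
    ∣∣-*        : ∀ x y → ∣ x * y ∣ ≡ ∣ x ∣ ·ᴹ ∣ y ∣
    ultrametric : ∀ x y → ∣ x + y ∣ ≤ᴹ ∣ x ∣ ⊔ᴹ ∣ y ∣

  IsCauchy : (ℕ → Carrier) → Set
  IsCauchy u = ∀ (r : ℚ) → ∃[ N ] ∀ m n → N ℕ.≤ m → N ℕ.≤ n → ∣ u m - u n ∣ ≤ᴹ p^ r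

  ConvergesTo : (ℕ → Carrier) → Carrier → Set
  ConvergesTo u x = ∀ (r : ℚ) → ∃[ N ] ∀ n → N ℕ.≤ n → ∣ u n - x ∣ ≤ᴹ p^ r

  IsComplete : Set c
  IsComplete = ∀ u → IsCauchy u → ∃ (ConvergesTo u)

-- x^d + a_{d-1} x^{d-1} + … + a_0
monic : (R : RawRing c ℓ₁) → let open RawRing R in
        ∀ {d} → (Fin d → Carrier) → Carrier → Carrier
monic R {d} a x = x ^ d + sum (λ i → a i * x ^ toℕ i)
  where
  open RawRing R
  open RawSemiringDefs rawSemiring using (_^_; sum)

record IsCompletion {a} {ℓ} (R : RawRing a ℓ) (norm : RawRing.Carrier R → Magnitude)
                    (L : ValuedField c ℓ₁ ℓ₂)
                    (ι : RawRing.Carrier R → ValuedField.Carrier L)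
                    : Set (a ⊔ ℓ ⊔ c ⊔ ℓ₁) where
  open ValuedField L
  field
    homomorphic : IsRingHomomorphism R rawRing ι
    isometric   : ∀ x → ∣ ι x ∣ ≡ norm x
    dense       : ∀ y (r : ℚ) → ∃[ x ] ∣ y - ι x ∣ ≤ᴹ p^ r
    complete    : IsComplete

record IsAlgebraicClosure (K L : ValuedField c ℓ₁ ℓ₂)
                          (ι : ValuedField.Carrier K → ValuedField.Carrier L)
                          : Set (c ⊔ ℓ₁) where
  private
    module K = ValuedField K
    module L = ValuedField L
  field
    homomorphic : IsRingHomomorphism K.rawRing L.rawRing ι
    isometric   : ∀ x → L.∣ ι x ∣ ≡ K.∣ x ∣
    algebraic   : ∀ y → ∃[ d ] Σ[ a ∈ (Fin (suc d) → K.Carrier) ]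
                    monic L.rawRing (ι ∘ a) y L.≈ L.0#
    closed      : ∀ {d} (a : Fin (suc d) → L.Carrier) →
                    ∃[ x ] monic L.rawRing a x L.≈ L.0#

-- ℂₚ is determined only up to isometric isomorphism (and the library has
-- neither ℚₚ nor algebraic closures), so it is given by its construction
-- ℚ → ℚₚ → ℚ̄ₚ → ℂₚ: completion, algebraic closure, completion.

record PAdicComplexNumbers (p : ℕ) c ℓ₁ ℓ₂ : Set (lsuc (c ⊔ ℓ₁ ⊔ ℓ₂)) where
  field
    ℚₚ ℚ̄ₚ ℂₚ : ValuedField c ℓ₁ ℓ₂

  private
    module ℚₚ = ValuedField ℚₚ
    module ℚ̄ₚ = ValuedField ℚ̄ₚ
    module ℂₚ = ValuedField ℂₚ

  field
    ι₁ : ℚ → ℚₚ.Carrier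
    ι₂ : ℚₚ.Carrier → ℚ̄ₚ.Carrier
    ι₃ : ℚ̄ₚ.Carrier → ℂₚ.Carrier
    ℚₚ-isCompletion       : IsCompletion ℚ.+-*-rawRing (padicAbs p) ℚₚ ι₁
    ℚ̄ₚ-isAlgebraicClosure : IsAlgebraicClosure ℚₚ ℚ̄ₚ ι₂
    ℂₚ-isCompletion       : IsCompletion ℚ̄ₚ.rawRing ℚ̄ₚ.∣_∣ ℂₚ ι₃

  ℤₚ : Set c
  ℤₚ = Σ[ x ∈ ℚₚ.Carrier ] ℚₚ.∣ x ∣ ≤ᴹ p^ 0ℚ

  fromℤₚ : ℤₚ → ℂₚ.Carrier
  fromℤₚ = ι₃ ∘ ι₂ ∘ proj₁

module Euler (K : ValuedField c ℓ₁ ℓ₂) where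

  open ValuedField K
  open RawSemiringDefs (RawRing.rawSemiring rawRing) public using (_^_; sum)
  private module M = RawSemiringDefs (RawRing.rawSemiring rawRing)

  fromℕ : ℕ → Carrier
  fromℕ n = n M.× 1#

  infix  9 _⁻¹
  infixl 7 _/_

  ∣∣≡p^⇒#0 : ∀ {x r} → ∣ x ∣ ≡ p^ r → x # 0#
  ∣∣≡p^⇒#0 eq = proj₁ definite λ ∣x∣≡𝟎 → case ≡.trans (≡.sym eq) ∣x∣≡𝟎 of λ ()

  inverse : ∀ x (m : Magnitude) → ∣ x ∣ ≡ m → Carrier
  inverse x 𝟎      _  = 0#
  inverse x (p^ _) eq = proj₁ (#⇒invertible (∣∣≡p^⇒#0 eq))

  -- Total, with 0 ⁻¹ = 0.
  _⁻¹ : Carrier → Carrier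
  x ⁻¹ = inverse x ∣ x ∣ ≡.refl

  _/_ : Carrier → Carrier → Carrier
  x / y = x * y ⁻¹

  -- The sum over k = 0, …, n (upper bound included).
  ∑-syntax : ℕ → (ℕ → Carrier) → Carrier
  ∑-syntax n f = sum {suc n} (f ∘ toℕ)

  infixr 6 ∑-syntax
  syntax ∑-syntax n (λ k → e) = ∑[ k ≤ n ] e

  -- Formal power series in t: f k is the coefficient of tᵏ.
  Series : Set c
  Series = ℕ → Carrier

  infixl 6 _⊕_
  infixl 7 _⊛_ _•_

  _⊕_ : Series → Series → Series
  (f ⊕ g) n = f n + g n

  _⊛_ : Series → Series → Series
  (f ⊛ g) n = ∑[ k ≤ n ] f k * g (n ∸ k)

  _•_ : Carrier → Series → Series
  (a • f) n = a * f n

  one : Series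
  one zero    = 1#
  one (suc _) = 0#

  -- e^{xt}
  exp : Carrier → Series
  exp x n = x ^ n / fromℕ (n !)

  -- The coefficients b_n, …, b_0 of 1/g, from g_0 b_0 = 1 and
  -- g_0 b_{n+1} + Σ_{i=0}^{n} g_{i+1} b_{n-i} = 0.
  recipCoeffs : Series → (n : ℕ) → Vec Carrier (suc n)
  recipCoeffs g zero    = g 0 ⁻¹ ∷ []
  recipCoeffs g (suc n) = - (g 0 ⁻¹ * sum (λ i → g (suc (toℕ i)) * lookup bs i)) ∷ bs
    where bs = recipCoeffs g n

  -- 1/g, for g with g 0 ≠ 0
  recip : Series → Series
  recip g n = head (recipCoeffs g n)

  -- n! times the coefficient of tⁿ in 2/(re^t+1) e^{xt}
  E : ℕ → Carrier → Carrier → Carrier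
  E n r x = fromℕ (n !) * ((fromℕ 2 • recip (r • exp 1# ⊕ one)) ⊛ exp x) n

  -- T k r N = Σ_{i=0}^{N} (-1)ⁱ iᵏ rⁱ; here x ^ 0 = 1# for every x, including 0#.
  T : ℕ → Carrier → ℕ → Carrier
  T k r N = ∑[ i ≤ N ] (- 1#) ^ i * fromℕ i ^ k * r ^ i

  multinomial : (n k l m : ℕ) → Carrier
  multinomial n k l m = fromℕ (n !) / (fromℕ (k !) * fromℕ (l !) * fromℕ (m !))

  -- Σ f k l m over all k + l + m = n
  ∑-triples : ℕ → (ℕ → ℕ → ℕ → Carrier) → Carrier
  ∑-triples n f = ∑[ k ≤ n ] ∑[ l ≤ n ∸ k ] f k l (n ∸ k ∸ l)

{-# OPTIONS --safe #-}

-- With S₁ = Σ_{i<w₁} (-q^{w₂} e^{w₂t})ⁱ and S₂ = Σ_{j<w₂} (-q^{w₁} e^{w₁t})ʲ, all eight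
-- expressions are n! times the coefficient of tⁿ in
--   2 / (q^{w₁w₂} e^{w₁w₂t} + 1) · e^{w₁w₂yt} · S₁ · S₂.
-- As w₁ is odd, the geometric sum gives (q^{w₂} e^{w₂t} + 1) S₁ = q^{w₁w₂} e^{w₁w₂t} + 1, so S₁
-- can be absorbed into the denominator; likewise S₂.  What remains is to expand each factor either
-- through the coefficients T or as a sum of exponentials, which shift the argument of E.
-- The denominators are invertible because |q^w - 1| < 1 = |-2| for odd p.

module Submission where

open import Defs
open import Algebra.Bundles using (CommutativeRing)
import Algebra.Definitions.RawMonoid as RawMonoidDefs
open import Algebra.Morphism.Construct.Composition using (isRingHomomorphism)
open import Algebra.Morphism.Structures using (IsRingHomomorphism)
import Algebra.Properties.CommutativeSemigroup as CommutativeSemigroupProperties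
import Algebra.Properties.CommutativeSemiring.Binomial as Binomial
import Algebra.Properties.CommutativeSemiring.Exp as Exp
import Algebra.Properties.Ring as RingProperties
import Algebra.Properties.Semiring.Mult as Mult
import Algebra.Properties.Semiring.Sum as Sum
import Algebra.Solver.Ring.NaturalCoefficients.Default as Solver
open import Data.Fin.Base using (Fin; toℕ; zero; suc)
open import Data.Fin.Properties using (toℕ<n)
import Data.Integer.Base as ℤ
open import Data.List.Base using (List; _∷_; [])
open import Data.List.Relation.Unary.All as All using (All; _∷_; [])
open import Data.List.Relation.Unary.AllPairs using (AllPairs; _∷_; [])
open import Data.Nat.Base as ℕ using (ℕ; zero; suc; 2+; _∸_; _!; _≤_; _<_; NonZero; NonTrivial)
open import Data.Nat.Combinatorics using (_C_; nCk≡n!/k![n-k]!; k![n∸k]!∣n!)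
open import Data.Nat.DivMod using (m/n*n≡m)
open import Data.Nat.Divisibility using (_∣_; _∣?_; _∣0; ∣-refl; ∣-trans; ∣m∣n⇒∣m+n; m∣m*n; >⇒∤)
open import Data.Nat.Primality using (Prime; prime⇒nonTrivial; ¬prime[0]; ¬prime[1])
import Data.Nat.Properties as ℕₚ
open import Data.Product.Base using (_,_; proj₁; proj₂)
open import Data.Rational.Base as ℚ using (ℚ; 0ℚ; 1ℚ; mkℚ)
import Data.Rational.Properties as ℚₚ
open import Data.Sum.Base using (inj₁; inj₂)
open import Data.Vec.Base using (lookup)
open import Function.Base using (_∘_)
open import Level using (Level)
open import Relation.Binary.Bundles using (Setoid)
import Relation.Binary.Construct.Add.Infimum.Strict as AddInfimum<
open import Relation.Binary.PropositionalEquality as ≡ using (_≡_; _≢_)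
import Relation.Binary.Reasoning.Setoid as SetoidReasoning
open import Relation.Nullary using (¬_; contradiction)
open import Relation.Nullary.Decidable using (dec-false)
open AddInfimum< ℚ._<_ using (⊥₋<[_]; [_])

-- Two facts about the absolute value carry the argument from `ℂₚ` to formal series: positive
-- integers have nonzero magnitude, which makes division by `n !` and by `W₁`, `W₂` genuine, and
-- `q ^ w + 1#` has nonzero magnitude. Both are phrased as `∣ x ∣ ≢ 𝟎`, because the total inverse
-- `⁻¹` looks at the magnitude to choose between a true inverse and the default `0#`. The obstacle
-- is that `E` is built from the reciprocal of `r e^t + 1` alone, whereas the product contains
-- `e^{ut}` for several `u`. The powers of `w₁` and `w₂` in the eight expressions make up the
-- difference: `u^k E_k / k!` is a coefficient after the substitution `t ↦ ut`, which respects
-- products. A factor `S₁` or `S₂` is then absorbed by uniqueness of inverses: two series inverse to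
-- the same denominator agree in the commutative ring of power series.

private variable
  a ℓ : Level

-- Odd numbers, factorials and pairwise equality.

odd-suc-suc : ∀ {n} → Odd (2+ n) → Odd n
odd-suc-suc odd 2∣n = odd (∣m∣n⇒∣m+n ∣-refl 2∣n)

nCk*k!*[n∸k]!≡n! : ∀ {n k} → k ≤ n → (n C k) ℕ.* (k ! ℕ.* (n ∸ k) !) ≡ n !
nCk*k!*[n∸k]!≡n! {n} {k} k≤n = ≡.trans
  (≡.cong (ℕ._* (k ! ℕ.* (n ∸ k) !)) (nCk≡n!/k![n-k]! k≤n))
  (m/n*n≡m {{k ℕₚ.!* (n ∸ k) !≢0}} (k![n∸k]!∣n! k≤n))

-- Reduces the 28 equalities among eight expressions to eight comparisons with one common value `x`.
all≈⇒allPairs : (S : Setoid a ℓ) → let open Setoid S in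
  ∀ {x} {ys : List Carrier} → All (_≈ x) ys → AllPairs _≈_ ys
all≈⇒allPairs S []         = []
all≈⇒allPairs S (y≈x ∷ zs) =
  All.map (λ z≈x → Setoid.trans S y≈x (Setoid.sym S z≈x)) zs ∷ all≈⇒allPairs S zs

-- Identities in a commutative ring, used for scalars and for series.

module RingIdentities (R : CommutativeRing a ℓ) where

  open CommutativeRing R
  open RingProperties ring
  open Exp commutativeSemiring using (_^_)
  open Sum semiring using (sum; *-distribˡ-sum)
  open SetoidReasoning setoid

  -- The sum unfolds as 1 + z (1 + z + ...), so the induction removes the first term instead of the
  -- last. The product form makes sense in the ring of series, where `1# - z` need not be
  -- invertible.
  geometric-sum : ∀ z n → (1# - z) * sum {n} (λ i → z ^ toℕ i) ≈ 1# - z ^ n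
  geometric-sum z zero    = trans (zeroʳ _) (sym (-‿inverseʳ 1#))
  geometric-sum z (suc n) = begin
    (1# - z) * (1# + sum {n} (λ i → z * z ^ toℕ i))
      ≈⟨ *-congˡ (+-congˡ (*-distribˡ-sum z (λ (i : Fin n) → z ^ toℕ i))) ⟨
    (1# - z) * (1# + z * s)           ≈⟨ distribˡ _ _ _ ⟩
    (1# - z) * 1# + (1# - z) * (z * s) ≈⟨ +-cong (*-identityʳ _) (x∙yz≈y∙xz (1# - z) z s) ⟩
    (1# - z) + z * ((1# - z) * s)     ≈⟨ +-congˡ (*-congˡ (geometric-sum z n)) ⟩
    (1# - z) + z * (1# - z ^ n)       ≈⟨ +-congˡ (x[y-z]≈xy-xz z 1# (z ^ n)) ⟩
    (1# - z) + (z * 1# - z * z ^ n)   ≈⟨ +-congˡ (+-congʳ (*-identityʳ z)) ⟩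
    (1# - z) + (z - z * z ^ n)        ≈⟨ +-assoc 1# (- z) _ ⟩
    1# + (- z + (z - z * z ^ n))      ≈⟨ +-congˡ (+-assoc (- z) z _) ⟨
    1# + ((- z + z) - z * z ^ n)      ≈⟨ +-congˡ (+-congʳ (-‿inverseˡ z)) ⟩
    1# + (0# - z * z ^ n)             ≈⟨ +-congˡ (+-identityˡ _) ⟩
    1# - z * z ^ n                    ∎
    where
    s = sum {n} (λ i → z ^ toℕ i)
    open CommutativeSemigroupProperties *-commutativeSemigroup using (x∙yz≈y∙xz)

  -x*-y≈x*y : ∀ x y → - x * - y ≈ x * y
  -x*-y≈x*y x y = begin
    - x * - y     ≈⟨ -‿distribˡ-* x (- y) ⟨
    - (x * - y)   ≈⟨ -‿cong (-‿distribʳ-* x y) ⟨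
    - - (x * y)   ≈⟨ -‿involutive (x * y) ⟩
    x * y         ∎

  -- Induction in steps of two, the signs of each pair of factors cancelling. It turns the
  -- `1 - (-r)^w` left by the geometric sum into `1 + r^w`.
  -x^odd≈-[x^odd] : ∀ x n → Odd n → (- x) ^ n ≈ - (x ^ n)
  -x^odd≈-[x^odd] x 0      odd = contradiction (2 ∣0) odd
  -x^odd≈-[x^odd] x 1      odd = sym (-‿distribˡ-* x 1#)
  -x^odd≈-[x^odd] x (2+ n) odd = begin
    - x * (- x * (- x) ^ n)   ≈⟨ *-assoc (- x) (- x) _ ⟨
    - x * - x * (- x) ^ n     ≈⟨ *-cong (-x*-y≈x*y x x) (-x^odd≈-[x^odd] x n (odd-suc-suc odd)) ⟩
    x * x * - (x ^ n)         ≈⟨ -‿distribʳ-* (x * x) (x ^ n) ⟨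
    - (x * x * x ^ n)         ≈⟨ -‿cong (*-assoc x x _) ⟩
    - (x * (x * x ^ n))       ∎

  unique-inverse : ∀ {x y z} → y * x ≈ 1# → x * z ≈ 1# → y ≈ z
  unique-inverse {x} {y} {z} yx≈1 xz≈1 = begin
    y            ≈⟨ *-identityʳ y ⟨
    y * 1#       ≈⟨ *-congˡ xz≈1 ⟨
    y * (x * z)  ≈⟨ *-assoc y x z ⟨
    y * x * z    ≈⟨ *-congʳ yx≈1 ⟩
    1# * z       ≈⟨ *-identityˡ z ⟩
    z            ∎

-- The commutative ring of formal power series.

module FormalSeries {c ℓ₁ ℓ₂} (K : ValuedField c ℓ₁ ℓ₂) where

  open ValuedField K hiding (zero)
  open Euler K
  open CommutativeRing commutativeRing using (semiring; commutativeSemiring; ring)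
  open RingProperties ring using (-‿distribʳ-*; -0#≈0#)
  open Exp commutativeSemiring using (^-homo-*)
  open Solver commutativeSemiring using (solve; _:=_; _:*_)
  open SetoidReasoning setoid

  ∑-cong : ∀ n {f g : ℕ → Carrier} → (∀ k → k ≤ n → f k ≈ g k) →
           (∑[ k ≤ n ] f k) ≈ (∑[ k ≤ n ] g k)
  ∑-cong n f≈g = Sum.sum-cong-≋ semiring (λ i → f≈g (toℕ i) (ℕₚ.≤-pred (toℕ<n i)))

  ∑-distrib-+ : ∀ n (f g : ℕ → Carrier) →
                (∑[ k ≤ n ] (f k + g k)) ≈ (∑[ k ≤ n ] f k) + (∑[ k ≤ n ] g k)
  ∑-distrib-+ n f g = Sum.∑-distrib-+ semiring {suc n} (f ∘ toℕ) (g ∘ toℕ)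

  *-distribˡ-∑ : ∀ n x (f : ℕ → Carrier) → x * (∑[ k ≤ n ] f k) ≈ (∑[ k ≤ n ] x * f k)
  *-distribˡ-∑ n x f = Sum.*-distribˡ-sum semiring {suc n} x (f ∘ toℕ)

  *-distribʳ-∑ : ∀ n x (f : ℕ → Carrier) → (∑[ k ≤ n ] f k) * x ≈ (∑[ k ≤ n ] f k * x)
  *-distribʳ-∑ n x f = Sum.*-distribʳ-sum semiring {suc n} x (f ∘ toℕ)

  ∑-comm : ∀ m n (f : ℕ → ℕ → Carrier) →
           (∑[ i ≤ m ] ∑[ j ≤ n ] f i j) ≈ (∑[ j ≤ n ] ∑[ i ≤ m ] f i j)
  ∑-comm m n f = Sum.∑-comm semiring {suc m} {suc n} (λ i j → f (toℕ i) (toℕ j))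

  infix 4 _≋_

  -- A record instead of a function type, so that unification can recover `f` and `g` from the type
  -- of a proof.
  record _≋_ (f g : Series) : Set ℓ₁ where
    constructor coefficientwise
    field coefficient : ∀ n → f n ≈ g n

  open _≋_ public

  tail : Series → Series
  tail f n = f (suc n)

  ≋-refl : ∀ {f} → f ≋ f
  ≋-refl = coefficientwise λ _ → refl

  ≋-sym : ∀ {f g} → f ≋ g → g ≋ f
  ≋-sym f≋g = coefficientwise λ n → sym (coefficient f≋g n)

  ≋-trans : ∀ {f g h} → f ≋ g → g ≋ h → f ≋ h
  ≋-trans f≋g g≋h = coefficientwise λ n → trans (coefficient f≋g n) (coefficient g≋h n)

  ⊕-cong : ∀ {f f′ g g′} → f ≋ f′ → g ≋ g′ → f ⊕ g ≋ f′ ⊕ g′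
  ⊕-cong f≋ g≋ = coefficientwise λ n → +-cong (coefficient f≋ n) (coefficient g≋ n)

  •-cong : ∀ {x y f g} → x ≈ y → f ≋ g → x • f ≋ y • g
  •-cong x≈y f≋g = coefficientwise λ n → *-cong x≈y (coefficient f≋g n)

  ⊛-cong : ∀ {f f′ g g′} → f ≋ f′ → g ≋ g′ → f ⊛ g ≋ f′ ⊛ g′
  ⊛-cong f≋ g≋ = coefficientwise λ n →
    ∑-cong n λ k _ → *-cong (coefficient f≋ k) (coefficient g≋ (n ∸ k))

  ⊛-distribʳ : ∀ f g h → (g ⊕ h) ⊛ f ≋ g ⊛ f ⊕ h ⊛ f
  ⊛-distribʳ f g h = coefficientwise λ n → trans
    (∑-cong n λ k _ → distribʳ (f (n ∸ k)) (g k) (h k))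
    (∑-distrib-+ n (λ k → g k * f (n ∸ k)) (λ k → h k * f (n ∸ k)))

  •-⊛ : ∀ x f g → (x • f) ⊛ g ≋ x • (f ⊛ g)
  •-⊛ x f g = coefficientwise λ n → trans
    (∑-cong n λ k _ → *-assoc x (f k) (g (n ∸ k)))
    (sym (*-distribˡ-∑ n x (λ k → f k * g (n ∸ k))))

  -- By computation a Cauchy product splits off its first term, leaving `tail f ⊛ g`. This is the
  -- mirror image, splitting off the last term; the two together give commutativity.
  ⊛-tailʳ : ∀ f g n → (f ⊛ g) (suc n) ≈ (f ⊛ tail g) n + f (suc n) * g 0
  ⊛-tailʳ f g zero = begin
    f 0 * g 1 + (f 1 * g 0 + 0#)   ≈⟨ +-congˡ (+-identityʳ _) ⟩
    f 0 * g 1 + f 1 * g 0          ≈⟨ +-congʳ (+-identityʳ _) ⟨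
    f 0 * g 1 + 0# + f 1 * g 0     ∎
  ⊛-tailʳ f g (suc n) = begin
    f 0 * g (2+ n) + (tail f ⊛ g) (suc n)
      ≈⟨ +-congˡ (⊛-tailʳ (tail f) g n) ⟩
    f 0 * g (2+ n) + ((tail f ⊛ tail g) n + f (2+ n) * g 0)
      ≈⟨ +-assoc _ _ _ ⟨
    (f ⊛ tail g) (suc n) + f (2+ n) * g 0 ∎

  ⊛-comm : ∀ f g → f ⊛ g ≋ g ⊛ f
  ⊛-comm f g = coefficientwise (go f g)
    where
    go : ∀ f g n → (f ⊛ g) n ≈ (g ⊛ f) n
    go f g zero    = +-congʳ (*-comm (f 0) (g 0))
    go f g (suc n) = begin
      f 0 * g (suc n) + (tail f ⊛ g) n  ≈⟨ +-cong (*-comm _ _) (go (tail f) g n) ⟩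
      g (suc n) * f 0 + (g ⊛ tail f) n  ≈⟨ +-comm _ _ ⟩
      (g ⊛ tail f) n + g (suc n) * f 0  ≈⟨ ⊛-tailʳ g f n ⟨
      (g ⊛ f) (suc n)                   ∎

  -- The tail of `f ⊛ g` is by computation `(f 0 • tail g) ⊕ (tail f ⊛ g)`. Distributing `h` over it
  -- leaves the same claim for `tail f` at a smaller index.
  ⊛-assoc : ∀ f g h → (f ⊛ g) ⊛ h ≋ f ⊛ (g ⊛ h)
  ⊛-assoc f g h = coefficientwise (go f)
    where
    go : ∀ f n → ((f ⊛ g) ⊛ h) n ≈ (f ⊛ (g ⊛ h)) n
    go f zero    = +-congʳ (begin
      (f 0 * g 0 + 0#) * h 0    ≈⟨ *-congʳ (+-identityʳ _) ⟩
      f 0 * g 0 * h 0           ≈⟨ *-assoc _ _ _ ⟩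
      f 0 * (g 0 * h 0)         ≈⟨ *-congˡ (+-identityʳ _) ⟨
      f 0 * (g 0 * h 0 + 0#)    ∎)
    go f (suc n) = begin
      (f ⊛ g) 0 * h (suc n) + (((f 0 • tail g) ⊕ (tail f ⊛ g)) ⊛ h) n
        ≈⟨ +-cong (*-congʳ (+-identityʳ _)) (coefficient (⊛-distribʳ h (f 0 • tail g) (tail f ⊛ g)) n) ⟩
      f 0 * g 0 * h (suc n) + (((f 0 • tail g) ⊛ h) n + ((tail f ⊛ g) ⊛ h) n)
        ≈⟨ +-cong (*-assoc _ _ _) (+-cong (coefficient (•-⊛ (f 0) (tail g) h) n) (go (tail f) n)) ⟩
      f 0 * (g 0 * h (suc n)) + (f 0 * (tail g ⊛ h) n + (tail f ⊛ (g ⊛ h)) n)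
        ≈⟨ +-assoc _ _ _ ⟨
      f 0 * (g 0 * h (suc n)) + f 0 * (tail g ⊛ h) n + (tail f ⊛ (g ⊛ h)) n
        ≈⟨ +-congʳ (distribˡ _ _ _) ⟨
      f 0 * (g ⊛ h) (suc n) + (tail f ⊛ (g ⊛ h)) n ∎

  zeroSeries : Series
  zeroSeries _ = 0#

  ⊖_ : Series → Series
  (⊖ f) n = - f n

  zeroSeries-⊛ : ∀ f n → (zeroSeries ⊛ f) n ≈ 0#
  zeroSeries-⊛ f n = trans (∑-cong n λ k _ → zeroˡ (f (n ∸ k)))
    (Sum.sum-replicate-zero semiring (suc n))

  ⊛-identityˡ : ∀ f → one ⊛ f ≋ f
  ⊛-identityˡ f = coefficientwise λ where
    zero    → trans (+-identityʳ _) (*-identityˡ _)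
    (suc n) → begin
      1# * f (suc n) + (zeroSeries ⊛ f) n  ≈⟨ +-cong (*-identityˡ _) (zeroSeries-⊛ f n) ⟩
      f (suc n) + 0#                       ≈⟨ +-identityʳ _ ⟩
      f (suc n)                            ∎

  seriesRing : CommutativeRing c ℓ₁
  seriesRing = record
    { Carrier = Series ; _≈_ = _≋_ ; _+_ = _⊕_ ; _*_ = _⊛_ ; -_ = ⊖_ ; 0# = zeroSeries ; 1# = one
    ; isCommutativeRing = record
      { isRing = record
        { +-isAbelianGroup = record
          { isGroup = record
            { isMonoid = record
              { isSemigroup = record
                { isMagma = record
                  { isEquivalence = record { refl = ≋-refl ; sym = ≋-sym ; trans = ≋-trans }
                  ; ∙-cong = ⊕-cong
                  }
                ; assoc = λ f g h → coefficientwise λ n → +-assoc (f n) (g n) (h n)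
                }
              ; identity = (λ f → coefficientwise λ n → +-identityˡ (f n))
                         , (λ f → coefficientwise λ n → +-identityʳ (f n))
              }
            ; inverse = (λ f → coefficientwise λ n → -‿inverseˡ (f n))
                      , (λ f → coefficientwise λ n → -‿inverseʳ (f n))
            ; ⁻¹-cong = λ f≋g → coefficientwise λ n → -‿cong (coefficient f≋g n)
            }
          ; comm = λ f g → coefficientwise λ n → +-comm (f n) (g n)
          }
        ; *-cong = ⊛-cong
        ; *-assoc = ⊛-assoc
        ; *-identity = ⊛-identityˡ , λ f → ≋-trans (⊛-comm f one) (⊛-identityˡ f)
        ; distrib = (λ f g h → ≋-trans (⊛-comm f (g ⊕ h)) (≋-trans (⊛-distribʳ f g h)
                       (⊕-cong (⊛-comm g f) (⊛-comm h f))))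
                  , ⊛-distribʳ
        }
      ; *-comm = ⊛-comm
      }
    }

  ∑-⊛ : ∀ m (F : ℕ → Series) g n →
        ((λ j → ∑[ i ≤ m ] F i j) ⊛ g) n ≈ (∑[ i ≤ m ] (F i ⊛ g) n)
  ∑-⊛ m F g n = trans
    (∑-cong n λ k _ → *-distribʳ-∑ m (g (n ∸ k)) (λ i → F i k))
    (∑-comm n m (λ k i → F i k * g (n ∸ k)))

  -- The substitution `t ↦ xt`.
  scale : Carrier → Series → Series
  scale x f n = x ^ n * f n

  scale-cong : ∀ {x f g} → f ≋ g → scale x f ≋ scale x g
  scale-cong f≋g = coefficientwise λ n → *-congˡ (coefficient f≋g n)

  x^[n∸k]*x^k≈x^n : ∀ x {n k} → k ≤ n → x ^ (n ∸ k) * x ^ k ≈ x ^ n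
  x^[n∸k]*x^k≈x^n x {n} {k} k≤n = begin
    x ^ (n ∸ k) * x ^ k  ≈⟨ ^-homo-* x (n ∸ k) k ⟨
    x ^ (n ∸ k ℕ.+ k)    ≡⟨ ≡.cong (x ^_) (ℕₚ.m∸n+n≡m k≤n) ⟩
    x ^ n                ∎

  scale-⊛ : ∀ x f g → scale x (f ⊛ g) ≋ scale x f ⊛ scale x g
  scale-⊛ x f g = coefficientwise λ n → trans
    (*-distribˡ-∑ n (x ^ n) (λ k → f k * g (n ∸ k)))
    (∑-cong n λ k k≤n → begin
      x ^ n * (f k * g (n ∸ k))
        ≈⟨ *-congʳ (x^[n∸k]*x^k≈x^n x k≤n) ⟨
      x ^ (n ∸ k) * x ^ k * (f k * g (n ∸ k))
        ≈⟨ solve 4 (λ a b c d → a :* b :* (c :* d) := b :* c :* (a :* d)) refl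
             (x ^ (n ∸ k)) (x ^ k) (f k) (g (n ∸ k)) ⟩
      x ^ k * f k * (x ^ (n ∸ k) * g (n ∸ k)) ∎)

  scale-one : ∀ x → scale x one ≋ one
  scale-one x = coefficientwise λ where
    zero    → *-identityˡ 1#
    (suc n) → zeroʳ _

  -- The definition of `⁻¹` matches on `∣ x ∣` together with an equation, so the magnitude is
  -- generalised to a variable `m` before the case split.
  *-⁻¹ : ∀ {x} → ∣ x ∣ ≢ 𝟎 → x * x ⁻¹ ≈ 1#
  *-⁻¹ {x} ∣x∣≢𝟎 = *-inverse ∣ x ∣ ≡.refl ∣x∣≢𝟎
    where
    *-inverse : ∀ m (eq : ∣ x ∣ ≡ m) → m ≢ 𝟎 → x * inverse x m eq ≈ 1#
    *-inverse 𝟎      eq m≢𝟎 = contradiction ≡.refl m≢𝟎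
    *-inverse (p^ r) eq m≢𝟎 = begin
      -- Apartness `x # 0#` yields an inverse of the difference `x - 0#`, not of `x` literally.
      x * y         ≈⟨ *-congʳ (trans (+-congˡ -0#≈0#) (+-identityʳ x)) ⟨
      (x - 0#) * y  ≈⟨ proj₂ (proj₂ x-0-invertible) ⟩
      1#            ∎
      where
      x-0-invertible = #⇒invertible (∣∣≡p^⇒#0 eq)
      y = proj₁ x-0-invertible

  -- The vector lists coefficients from the highest index down, so the sum in its recursion is
  -- already in the order of a Cauchy product.
  lookup-recipCoeffs : ∀ g n (i : Fin (suc n)) → lookup (recipCoeffs g n) i ≡ recip g (n ∸ toℕ i)
  lookup-recipCoeffs g zero    zero    = ≡.refl
  lookup-recipCoeffs g (suc n) zero    = ≡.refl
  lookup-recipCoeffs g (suc n) (suc i) = lookup-recipCoeffs g n i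

  -- In degree `suc n` the terms after the first sum to `s`, and the new coefficient of `recip g`
  -- was chosen so that the first term is `- s`.
  ⊛-recip : ∀ {g} → ∣ g 0 ∣ ≢ 𝟎 → g ⊛ recip g ≋ one
  ⊛-recip {g} g₀≢0 = coefficientwise λ where
    zero    → trans (+-identityʳ _) (*-⁻¹ g₀≢0)
    (suc n) → let
        s = sum {suc n} (λ i → g (suc (toℕ i)) * lookup (recipCoeffs g n) i)
      in begin
      g 0 * - (g 0 ⁻¹ * s) + (∑[ k ≤ n ] g (suc k) * recip g (n ∸ k))
        ≈⟨ +-congˡ (Sum.sum-cong-≋ semiring {suc n} λ i →
             *-congˡ {g (suc (toℕ i))} (reflexive (lookup-recipCoeffs g n i))) ⟨
      g 0 * - (g 0 ⁻¹ * s) + s   ≈⟨ +-congʳ (-‿distribʳ-* (g 0) (g 0 ⁻¹ * s)) ⟨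
      - (g 0 * (g 0 ⁻¹ * s)) + s ≈⟨ +-congʳ (-‿cong (*-assoc _ _ _)) ⟨
      - (g 0 * g 0 ⁻¹ * s) + s   ≈⟨ +-congʳ (-‿cong (*-congʳ (*-⁻¹ g₀≢0))) ⟩
      - (1# * s) + s             ≈⟨ +-congʳ (-‿cong (*-identityˡ s)) ⟩
      - s + s                    ≈⟨ -‿inverseˡ s ⟩
      0#                         ∎

  fromℕ-homo-* : ∀ m n → fromℕ (m ℕ.* n) ≈ fromℕ m * fromℕ n
  fromℕ-homo-* = Mult.×1-homo-* semiring

  fromℕ-* : ∀ n x → fromℕ n * x ≈ Mult._×_ semiring n x
  fromℕ-* n x = trans (Mult.×-assoc-* semiring n 1# x) (Mult.×-congʳ semiring n (*-identityˡ x))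

  ⊛-• : ∀ x f g → f ⊛ (x • g) ≋ x • (f ⊛ g)
  ⊛-• x f g = ≋-trans (⊛-comm f (x • g)) (≋-trans (•-⊛ x g f) (•-cong refl (⊛-comm g f)))

  module 𝕊 = CommutativeRing seriesRing
  open Exp 𝕊.commutativeSemiring public using () renaming (_^_ to _^ˢ_)
  open Sum 𝕊.semiring public using () renaming (sum to sumˢ)

  coefficient-sum : ∀ {m} (F : Fin m → Series) n → sumˢ F n ≡ sum (λ i → F i n)
  coefficient-sum {zero}  F n = ≡.refl
  coefficient-sum {suc m} F n = ≡.cong (F zero n +_) (coefficient-sum (F ∘ suc) n)

-- Exponential series in characteristic zero.

CharacteristicZero : ∀ {c ℓ₁ ℓ₂} → ValuedField c ℓ₁ ℓ₂ → Set
CharacteristicZero K = ∀ n → .{{_ : NonZero n}} → ∣ fromℕ n ∣ ≢ 𝟎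
  where
  open ValuedField K
  open Euler K

module ExponentialSeries {c ℓ₁ ℓ₂} (K : ValuedField c ℓ₁ ℓ₂) (∣n∣≢𝟎 : CharacteristicZero K) where

  open ValuedField K hiding (zero)
  open Euler K
  open FormalSeries K
  open CommutativeRing commutativeRing using (semiring; commutativeSemiring)
  open Exp commutativeSemiring using (^-congˡ; ^-distrib-*)
  open Solver commutativeSemiring using (solve; _:=_; _:*_)
  open SetoidReasoning setoid

  n!*n!⁻¹≈1 : ∀ n → fromℕ (n !) * fromℕ (n !) ⁻¹ ≈ 1#
  n!*n!⁻¹≈1 n = *-⁻¹ (∣n∣≢𝟎 (n !) {{n ℕₚ.!≢0}})

  n!-cancelˡ : ∀ n {x y} → fromℕ (n !) * x ≈ fromℕ (n !) * y → x ≈ y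
  n!-cancelˡ n {x} {y} eq = begin
    x                  ≈⟨ insert x ⟩
    n!⁻¹ * (n!# * x)   ≈⟨ *-congˡ eq ⟩
    n!⁻¹ * (n!# * y)   ≈⟨ insert y ⟨
    y                  ∎
    where
    n!# = fromℕ (n !)
    n!⁻¹ = n!# ⁻¹
    insert : ∀ z → z ≈ n!⁻¹ * (n!# * z)
    insert z = begin
      z                   ≈⟨ *-identityˡ z ⟨
      1# * z              ≈⟨ *-congʳ (n!*n!⁻¹≈1 n) ⟨
      n!# * n!⁻¹ * z      ≈⟨ *-congʳ (*-comm n!# n!⁻¹) ⟩
      n!⁻¹ * n!# * z      ≈⟨ *-assoc n!⁻¹ n!# z ⟩
      n!⁻¹ * (n!# * z)    ∎

  n!*[x/n!]≈x : ∀ n x → fromℕ (n !) * (x / fromℕ (n !)) ≈ x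
  n!*[x/n!]≈x n x = begin
    fromℕ (n !) * (x * fromℕ (n !) ⁻¹)
      ≈⟨ solve 3 (λ a b c → a :* (b :* c) := b :* (a :* c)) refl (fromℕ (n !)) x (fromℕ (n !) ⁻¹) ⟩
    x * (fromℕ (n !) * fromℕ (n !) ⁻¹)  ≈⟨ *-congˡ (n!*n!⁻¹≈1 n) ⟩
    x * 1#                              ≈⟨ *-identityʳ x ⟩
    x                                   ∎

  -- The product rule for exponential generating functions. It is the bridge between the binomial
  -- sums of the theorem and products of series.
  binomial-convolution : ∀ f g n →
    (∑[ k ≤ n ] fromℕ (n C k) * (fromℕ (k !) * f k) * (fromℕ ((n ∸ k) !) * g (n ∸ k)))
      ≈ fromℕ (n !) * (f ⊛ g) n
  binomial-convolution f g n = begin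
    (∑[ k ≤ n ] fromℕ (n C k) * (fromℕ (k !) * f k) * (fromℕ ((n ∸ k) !) * g (n ∸ k)))
      ≈⟨ (∑-cong n λ k k≤n → begin
        fromℕ (n C k) * (fromℕ (k !) * f k) * (fromℕ ((n ∸ k) !) * g (n ∸ k))
          ≈⟨ solve 5 (λ a b c d e → a :* (b :* c) :* (d :* e) := a :* (b :* d) :* (c :* e)) refl
               (fromℕ (n C k)) (fromℕ (k !)) (f k) (fromℕ ((n ∸ k) !)) (g (n ∸ k)) ⟩
        fromℕ (n C k) * (fromℕ (k !) * fromℕ ((n ∸ k) !)) * (f k * g (n ∸ k))
          ≈⟨ *-congʳ (*-congˡ (fromℕ-homo-* (k !) ((n ∸ k) !))) ⟨
        fromℕ (n C k) * fromℕ (k ! ℕ.* (n ∸ k) !) * (f k * g (n ∸ k))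
          ≈⟨ *-congʳ (fromℕ-homo-* (n C k) (k ! ℕ.* (n ∸ k) !)) ⟨
        fromℕ ((n C k) ℕ.* (k ! ℕ.* (n ∸ k) !)) * (f k * g (n ∸ k))
          ≡⟨ ≡.cong (λ m → fromℕ m * (f k * g (n ∸ k))) (nCk*k!*[n∸k]!≡n! k≤n) ⟩
        fromℕ (n !) * (f k * g (n ∸ k)) ∎) ⟩
    (∑[ k ≤ n ] fromℕ (n !) * (f k * g (n ∸ k)))
      ≈⟨ *-distribˡ-∑ n (fromℕ (n !)) (λ k → f k * g (n ∸ k)) ⟨
    fromℕ (n !) * (f ⊛ g) n ∎

  exp-cong : ∀ {x y} → x ≈ y → exp x ≋ exp y
  exp-cong x≈y = coefficientwise λ n → *-congʳ (^-congˡ n x≈y)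

  exp-0 : exp 0# ≋ one
  exp-0 = coefficientwise λ where
    zero    → trans (*-congʳ (sym (+-identityʳ 1#))) (n!*n!⁻¹≈1 0)
    (suc n) → trans (*-congʳ (zeroˡ _)) (zeroˡ _)

  -- After multiplication by `n !` this is the binomial theorem, read through
  -- `binomial-convolution`.
  exp-+ : ∀ x y → exp (x + y) ≋ exp x ⊛ exp y
  exp-+ x y = coefficientwise λ n → n!-cancelˡ n (begin
    fromℕ (n !) * exp (x + y) n      ≈⟨ n!*[x/n!]≈x n _ ⟩
    (x + y) ^ n                      ≈⟨ Binomial.theorem commutativeSemiring n x y ⟩
    sum {suc n} (λ k → Mult._×_ semiring (n C toℕ k) (x ^ toℕ k * y ^ (n ∸ toℕ k)))
      ≈⟨ (∑-cong n λ k _ → begin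
        Mult._×_ semiring (n C k) (x ^ k * y ^ (n ∸ k))  ≈⟨ fromℕ-* (n C k) _ ⟨
        fromℕ (n C k) * (x ^ k * y ^ (n ∸ k))            ≈⟨ *-assoc _ _ _ ⟨
        fromℕ (n C k) * x ^ k * y ^ (n ∸ k)
          ≈⟨ *-cong (*-congˡ (n!*[x/n!]≈x k _)) (n!*[x/n!]≈x (n ∸ k) _) ⟨
        fromℕ (n C k) * (fromℕ (k !) * exp x k) * (fromℕ ((n ∸ k) !) * exp y (n ∸ k)) ∎) ⟩
    (∑[ k ≤ n ] fromℕ (n C k) * (fromℕ (k !) * exp x k) * (fromℕ ((n ∸ k) !) * exp y (n ∸ k)))
      ≈⟨ binomial-convolution (exp x) (exp y) n ⟩
    fromℕ (n !) * (exp x ⊛ exp y) n ∎)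

  scale-exp : ∀ u x → scale u (exp x) ≋ exp (u * x)
  scale-exp u x = coefficientwise λ n → begin
    u ^ n * (x ^ n * fromℕ (n !) ⁻¹)  ≈⟨ *-assoc _ _ _ ⟨
    u ^ n * x ^ n * fromℕ (n !) ⁻¹    ≈⟨ *-congʳ (^-distrib-* u x n) ⟨
    (u * x) ^ n * fromℕ (n !) ⁻¹      ∎

-- Generating functions of the Euler polynomials and of the alternating sums.

module EulerSeries {c ℓ₁ ℓ₂} (K : ValuedField c ℓ₁ ℓ₂) (∣n∣≢𝟎 : CharacteristicZero K) where

  open ValuedField K hiding (zero)
  open Euler K
  open FormalSeries K
  open ExponentialSeries K ∣n∣≢𝟎
  open CommutativeRing commutativeRing using (ring; commutativeSemiring)
  open Exp commutativeSemiring using (^-congˡ; ^-distrib-*)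
  open Solver commutativeSemiring using (solve; _:=_; _:*_)
  open RingProperties ring using (-1*x≈-x; -‿distribˡ-*; -‿involutive)
  open RingIdentities commutativeRing using (-x^odd≈-[x^odd])
  open RingIdentities seriesRing using (geometric-sum; unique-inverse)
  open SetoidReasoning 𝕊.setoid

  [x•exp]^n : ∀ x u n → (x • exp u) ^ˢ n ≋ x ^ n • exp (u * fromℕ n)
  [x•exp]^n x u zero = 𝕊.sym (𝕊.trans (•-cong refl (𝕊.trans (exp-cong (zeroʳ u)) exp-0))
    (coefficientwise λ n → *-identityˡ (one n)))
  [x•exp]^n x u (suc n) = begin
    (x • exp u) ⊛ (x • exp u) ^ˢ n                  ≈⟨ 𝕊.*-congˡ {x • exp u} ([x•exp]^n x u n) ⟩
    (x • exp u) ⊛ (x ^ n • exp (u * fromℕ n))       ≈⟨ •-⊛ x (exp u) _ ⟩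
    x • (exp u ⊛ (x ^ n • exp (u * fromℕ n)))       ≈⟨ •-cong refl (⊛-• (x ^ n) (exp u) _) ⟩
    x • (x ^ n • (exp u ⊛ exp (u * fromℕ n)))       ≈⟨ coefficientwise (λ m → sym (*-assoc x (x ^ n) _)) ⟩
    x ^ suc n • (exp u ⊛ exp (u * fromℕ n))         ≈⟨ •-cong refl (exp-+ u (u * fromℕ n)) ⟨
    x ^ suc n • exp (u + u * fromℕ n)               ≈⟨ •-cong refl (exp-cong u*[1+n]) ⟨
    x ^ suc n • exp (u * fromℕ (suc n))             ∎
    where
    u*[1+n] : u * fromℕ (suc n) ≈ u + u * fromℕ n
    u*[1+n] = trans (distribˡ u 1# (fromℕ n)) (+-congʳ (*-identityʳ u))

  -- Σ_{i≤N} (-r e^{ut})ⁱ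
  altExp : Carrier → Carrier → ℕ → Series
  altExp r u N n = T n r N * u ^ n / fromℕ (n !)

  -1^i*r^i≈[-r]^i : ∀ r i → (- 1#) ^ i * r ^ i ≈ (- r) ^ i
  -1^i*r^i≈[-r]^i r i = trans (sym (^-distrib-* (- 1#) r i)) (^-congˡ i (-1*x≈-x r))

  -- Since `iⁿ uⁿ / n!` is the coefficient of `e^{uit}`, the sum inside `T` splits into
  -- exponentials. The form with `T` serves the binomial sums, this one the shifts of the argument
  -- of `E`.
  altExp-expansion : ∀ r u N n → altExp r u N n ≈ (∑[ i ≤ N ] (- r) ^ i * exp (u * fromℕ i) n)
  altExp-expansion r u N n = trans (*-assoc _ _ _)
    (trans (*-distribʳ-∑ N (u ^ n / fromℕ (n !)) (λ i → (- 1#) ^ i * fromℕ i ^ n * r ^ i))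
    (∑-cong N λ i _ → trans
      (solve 5 (λ a b c d e → a :* b :* c :* (d :* e) := a :* c :* (d :* b :* e)) refl
        ((- 1#) ^ i) (fromℕ i ^ n) (r ^ i) (u ^ n) (fromℕ (n !) ⁻¹))
      (*-cong (-1^i*r^i≈[-r]^i r i) (*-congʳ (sym (^-distrib-* u (fromℕ i) n))))))

  altExp-geometric : ∀ r u N → altExp r u N ≋ sumˢ {suc N} (λ i → (- r • exp u) ^ˢ toℕ i)
  altExp-geometric r u N = coefficientwise λ n → trans (altExp-expansion r u N n)
    (trans (∑-cong N λ i _ → sym (coefficient ([x•exp]^n (- r) u i) n))
    (reflexive (≡.sym (coefficient-sum {suc N} (λ i → (- r • exp u) ^ˢ toℕ i) n))))

  denominator : Carrier → Carrier → Series
  denominator r u = r • exp u ⊕ one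

  -- `s` is kept apart from `- r` so that one statement serves both ends of the geometric sum:
  -- `s = - r` at the start and `s = (- r) ^ w` at the close.
  denominator≋one-s•exp : ∀ {r s} u → s ≈ - r → denominator r u ≋ one ⊕ (⊖ (s • exp u))
  denominator≋one-s•exp {r} {s} u s≈-r = begin
    r • exp u ⊕ one         ≈⟨ 𝕊.+-comm (r • exp u) one ⟩
    one ⊕ r • exp u         ≈⟨ 𝕊.+-congˡ {one} (coefficientwise λ n → sym (negate (exp u n))) ⟩
    one ⊕ (⊖ (s • exp u))   ∎
    where
    negate : ∀ x → - (s * x) ≈ r * x
    negate x = trans (-‿distribˡ-* s x) (*-congʳ (trans (-‿cong s≈-r) (-‿involutive r)))

  denominator-⊛-altExp : ∀ r u w → Odd w →
    denominator r u ⊛ altExp r u (w ∸ 1) ≋ denominator (r ^ w) (u * fromℕ w)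
  -- The sum runs up to `w ∸ 1` inclusive, so it has `w` terms only for positive `w`; at `0` it
  -- would still have one.
  denominator-⊛-altExp r u zero        odd = contradiction (2 ∣0) odd
  denominator-⊛-altExp r u w@(suc w-1) odd = begin
    denominator r u ⊛ altExp r u w-1
      ≈⟨ ⊛-cong (denominator≋one-s•exp u refl) (altExp-geometric r u w-1) ⟩
    (one ⊕ (⊖ z)) ⊛ sumˢ {w} (λ i → z ^ˢ toℕ i)
      ≈⟨ geometric-sum z w ⟩
    one ⊕ (⊖ (z ^ˢ w))
      ≈⟨ 𝕊.+-congˡ {one} (𝕊.-‿cong ([x•exp]^n (- r) u w)) ⟩
    one ⊕ (⊖ ((- r) ^ w • exp (u * fromℕ w)))
      ≈⟨ denominator≋one-s•exp (u * fromℕ w) (-x^odd≈-[x^odd] r w odd) ⟨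
    denominator (r ^ w) (u * fromℕ w) ∎
    where z = - r • exp u

  -- The inverse of `r e^{ut} + 1`, obtained by substituting `t ↦ ut` in the reciprocal that occurs
  -- in `E`, so that it stays tied to the coefficients of `E`.
  scaledRecip : Carrier → Carrier → Series
  scaledRecip r u = scale u (recip (denominator r 1#))

  -- Multiplicativity of `scale` carries `⊛-recip` over from `u = 1#`; the hypothesis concerns the
  -- constant term `r + 1#`.
  denominator-⊛-scaledRecip : ∀ {r} u → ∣ r + 1# ∣ ≢ 𝟎 → denominator r u ⊛ scaledRecip r u ≋ one
  denominator-⊛-scaledRecip {r} u ∣r+1∣≢𝟎 = begin
    denominator r u ⊛ scaledRecip r u
      ≈⟨ 𝕊.*-congʳ {scaledRecip r u} scale-denominator ⟨
    scale u (denominator r 1#) ⊛ scaledRecip r u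
      ≈⟨ scale-⊛ u (denominator r 1#) (recip (denominator r 1#)) ⟨
    scale u (denominator r 1# ⊛ recip (denominator r 1#))
      ≈⟨ scale-cong (⊛-recip {denominator r 1#} (∣r+1∣≢𝟎 ∘ ≡.trans (∣∣-cong (sym constantTerm)))) ⟩
    scale u one  ≈⟨ scale-one u ⟩
    one          ∎
    where
    constantTerm : denominator r 1# 0 ≈ r + 1#
    constantTerm = +-congʳ (trans (*-congˡ
      (trans (*-congʳ (sym (+-identityʳ 1#))) (n!*n!⁻¹≈1 0))) (*-identityʳ r))
    scale-denominator : scale u (denominator r 1#) ≋ denominator r u
    scale-denominator = coefficientwise λ n → trans (distribˡ (u ^ n) (r * exp 1# n) (one n))
      (+-cong
        (trans (solve 3 (λ a b c → a :* (b :* c) := b :* (a :* c)) refl (u ^ n) r (exp 1# n))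
          (*-congˡ (trans (coefficient (scale-exp u 1#) n) (coefficient (exp-cong (*-identityʳ u)) n))))
        (coefficient (scale-one u) n))

  -- Both sides invert `denominator r u`: multiplying it by the alternating sum gives
  -- `denominator s v`, which `scaledRecip s v` cancels. `s` and `v` are given up to `≈` so that
  -- `q ^ (w₁ ℕ.* w₂)` and `W₁ * W₂` fit from either side.
  scaledRecip-factor : ∀ {r s u v} w → Odd w → s ≈ r ^ w → v ≈ u * fromℕ w →
    ∣ r + 1# ∣ ≢ 𝟎 → ∣ s + 1# ∣ ≢ 𝟎 →
    scaledRecip r u ≋ scaledRecip s v ⊛ altExp r u (w ∸ 1)
  scaledRecip-factor {r} {s} {u} {v} w odd s≈r^w v≈uw ∣r+1∣≢𝟎 ∣s+1∣≢𝟎 =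
    unique-inverse {D}
      (𝕊.trans (⊛-comm (scaledRecip r u) D) (denominator-⊛-scaledRecip u ∣r+1∣≢𝟎))
      (begin
        D ⊛ (R ⊛ A)            ≈⟨ 𝕊.*-congˡ {D} (⊛-comm R A) ⟩
        D ⊛ (A ⊛ R)            ≈⟨ ⊛-assoc D A R ⟨
        (D ⊛ A) ⊛ R            ≈⟨ 𝕊.*-congʳ {R} (denominator-⊛-altExp r u w odd) ⟩
        denominator (r ^ w) (u * fromℕ w) ⊛ R
          ≈⟨ 𝕊.*-congʳ {R} (⊕-cong (•-cong s≈r^w (exp-cong v≈uw)) (≋-refl {one})) ⟨
        denominator s v ⊛ R    ≈⟨ denominator-⊛-scaledRecip v ∣s+1∣≢𝟎 ⟩
        one                    ∎)
    where
    D = denominator r u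
    A = altExp r u (w ∸ 1)
    R = scaledRecip s v

  -- 2/(r e^{ut} + 1) e^{uxt}, with coefficients uⁿ E n r x / n!
  eulerSeries : Carrier → Carrier → Carrier → Series
  eulerSeries r u x = scale u ((fromℕ 2 • recip (denominator r 1#)) ⊛ exp x)

  eulerSeries-factor : ∀ r u x → eulerSeries r u x ≋ fromℕ 2 • (scaledRecip r u ⊛ exp (u * x))
  eulerSeries-factor r u x = begin
    eulerSeries r u x
      ≈⟨ scale-cong (•-⊛ (fromℕ 2) (recip (denominator r 1#)) (exp x)) ⟩
    scale u (fromℕ 2 • (recip (denominator r 1#) ⊛ exp x))
      ≈⟨ coefficientwise (λ n → solve 3 (λ a b c → a :* (b :* c) := b :* (a :* c)) refl
           (u ^ n) (fromℕ 2) ((recip (denominator r 1#) ⊛ exp x) n)) ⟩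
    fromℕ 2 • scale u (recip (denominator r 1#) ⊛ exp x)
      ≈⟨ •-cong refl (scale-⊛ u (recip (denominator r 1#)) (exp x)) ⟩
    fromℕ 2 • (scaledRecip r u ⊛ scale u (exp x))
      ≈⟨ •-cong refl (𝕊.*-congˡ {scaledRecip r u} (scale-exp u x)) ⟩
    fromℕ 2 • (scaledRecip r u ⊛ exp (u * x)) ∎

  -- Stated after multiplication by `u`, so that arguments such as `x + y / u` enter without
  -- division.
  eulerSeries-shift : ∀ {r u x z y} → u * z ≈ u * x + y →
    eulerSeries r u z ≋ eulerSeries r u x ⊛ exp y
  eulerSeries-shift {r} {u} {x} {z} {y} uz≈ux+y = begin
    eulerSeries r u z                        ≈⟨ eulerSeries-factor r u z ⟩
    fromℕ 2 • (R ⊛ exp (u * z))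
      ≈⟨ •-cong refl (𝕊.*-congˡ {R} (≋-trans (exp-cong uz≈ux+y) (exp-+ (u * x) y))) ⟩
    fromℕ 2 • (R ⊛ (exp (u * x) ⊛ exp y))    ≈⟨ •-cong refl (⊛-assoc R (exp (u * x)) (exp y)) ⟨
    fromℕ 2 • ((R ⊛ exp (u * x)) ⊛ exp y)    ≈⟨ •-⊛ (fromℕ 2) (R ⊛ exp (u * x)) (exp y) ⟨
    (fromℕ 2 • (R ⊛ exp (u * x))) ⊛ exp y    ≈⟨ 𝕊.*-congʳ {exp y} (eulerSeries-factor r u x) ⟨
    eulerSeries r u x ⊛ exp y                ∎
    where R = scaledRecip r u

  eulerSeries-reduce : ∀ {r s u v x y} w → Odd w → s ≈ r ^ w → v ≈ u * fromℕ w → u * x ≈ v * y →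
    ∣ r + 1# ∣ ≢ 𝟎 → ∣ s + 1# ∣ ≢ 𝟎 →
    eulerSeries r u x ≋ eulerSeries s v y ⊛ altExp r u (w ∸ 1)
  eulerSeries-reduce {r} {s} {u} {v} {x} {y} w odd s≈r^w v≈uw ux≈vy ∣r+1∣≢𝟎 ∣s+1∣≢𝟎 = begin
    eulerSeries r u x                              ≈⟨ eulerSeries-factor r u x ⟩
    fromℕ 2 • (scaledRecip r u ⊛ exp (u * x))
      ≈⟨ •-cong refl (⊛-cong (scaledRecip-factor w odd s≈r^w v≈uw ∣r+1∣≢𝟎 ∣s+1∣≢𝟎) (exp-cong ux≈vy)) ⟩
    fromℕ 2 • ((R ⊛ A) ⊛ exp (v * y))              ≈⟨ •-cong refl (xy∙z≈xz∙y R A (exp (v * y))) ⟩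
    fromℕ 2 • ((R ⊛ exp (v * y)) ⊛ A)              ≈⟨ •-⊛ (fromℕ 2) (R ⊛ exp (v * y)) A ⟨
    (fromℕ 2 • (R ⊛ exp (v * y))) ⊛ A              ≈⟨ 𝕊.*-congʳ {A} (eulerSeries-factor s v y) ⟨
    eulerSeries s v y ⊛ A                          ∎
    where
    R = scaledRecip s v
    A = altExp r u (w ∸ 1)
    open CommutativeSemigroupProperties 𝕊.*-commutativeSemigroup using (xy∙z≈xz∙y)

-- Each shape of sum in the theorem as a coefficient of a product of series.

module EulerIdentities {c ℓ₁ ℓ₂} (K : ValuedField c ℓ₁ ℓ₂) (∣n∣≢𝟎 : CharacteristicZero K) where

  open ValuedField K hiding (zero)
  open Euler K
  open FormalSeries K
  open ExponentialSeries K ∣n∣≢𝟎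
  open EulerSeries K ∣n∣≢𝟎
  open CommutativeRing commutativeRing using (commutativeSemiring)
  open Exp commutativeSemiring using (^-homo-*; ^-distrib-*; ^-assocʳ)
  open Solver commutativeSemiring using (solve; _:=_; _:*_; _:+_)
  open SetoidReasoning setoid

  n!*altExp≈T*u^n : ∀ r u N n → fromℕ (n !) * altExp r u N n ≈ T n r N * u ^ n
  n!*altExp≈T*u^n r u N n = n!*[x/n!]≈x n (T n r N * u ^ n)

  ∑-binomial-E-T : ∀ r s u v x N n →
    (∑[ k ≤ n ] fromℕ (n C k) * E k r x * T (n ∸ k) s N * v ^ (n ∸ k) * u ^ k)
      ≈ fromℕ (n !) * (eulerSeries r u x ⊛ altExp s v N) n
  ∑-binomial-E-T r s u v x N n = trans
    (∑-cong n λ k _ → begin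
      fromℕ (n C k) * E k r x * T (n ∸ k) s N * v ^ (n ∸ k) * u ^ k
        ≈⟨ solve 6 (λ a b c d e f → a :* (b :* c) :* d :* e :* f := a :* (b :* (f :* c)) :* (d :* e)) refl
             (fromℕ (n C k)) (fromℕ (k !)) (((fromℕ 2 • recip (denominator r 1#)) ⊛ exp x) k)
             (T (n ∸ k) s N) (v ^ (n ∸ k)) (u ^ k) ⟩
      fromℕ (n C k) * (fromℕ (k !) * eulerSeries r u x k) * (T (n ∸ k) s N * v ^ (n ∸ k))
        ≈⟨ *-congˡ (n!*altExp≈T*u^n s v N (n ∸ k)) ⟨
      fromℕ (n C k) * (fromℕ (k !) * eulerSeries r u x k) * (fromℕ ((n ∸ k) !) * altExp s v N (n ∸ k)) ∎)
    (binomial-convolution (eulerSeries r u x) (altExp s v N) n)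

  -- Splitting `v ^ n` as `v ^ (n ∸ k) * v ^ k` gives `T (n ∸ k)` its power of `v` and turns `u ^ k`
  -- into `(v * u) ^ k`. `I` stands for the inner sums over `i`, so `∑-E` can supply the hypothesis.
  ∑-binomial-T : ∀ s u v N (I F : Series) → (∀ k → (v * u) ^ k * I k ≈ fromℕ (k !) * F k) → ∀ n →
    v ^ n * (∑[ k ≤ n ] fromℕ (n C k) * T (n ∸ k) s N * u ^ k * I k)
      ≈ fromℕ (n !) * (F ⊛ altExp s v N) n
  ∑-binomial-T s u v N I F [vu]^k*I n = trans
    (*-distribˡ-∑ n (v ^ n) (λ k → fromℕ (n C k) * T (n ∸ k) s N * u ^ k * I k))
    (trans
      (∑-cong n λ k k≤n → begin
        v ^ n * (fromℕ (n C k) * T (n ∸ k) s N * u ^ k * I k)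
          ≈⟨ *-congʳ (x^[n∸k]*x^k≈x^n v k≤n) ⟨
        v ^ (n ∸ k) * v ^ k * (fromℕ (n C k) * T (n ∸ k) s N * u ^ k * I k)
          ≈⟨ solve 6 (λ a b c d e f → a :* b :* (c :* d :* e :* f) := c :* (b :* e :* f) :* (d :* a)) refl
               (v ^ (n ∸ k)) (v ^ k) (fromℕ (n C k)) (T (n ∸ k) s N) (u ^ k) (I k) ⟩
        fromℕ (n C k) * (v ^ k * u ^ k * I k) * (T (n ∸ k) s N * v ^ (n ∸ k))
          ≈⟨ *-cong (*-congˡ (trans (*-congʳ (sym (^-distrib-* v u k))) ([vu]^k*I k)))
               (sym (n!*altExp≈T*u^n s v N (n ∸ k))) ⟩
        fromℕ (n C k) * (fromℕ (k !) * F k) * (fromℕ ((n ∸ k) !) * altExp s v N (n ∸ k)) ∎)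
      (binomial-convolution F (altExp s v N) n))

  -- Moving the argument from `x` to `z i` multiplies the series by `e^{vit}`; with the weights
  -- `(-q^a)^i` these factors add up to `altExp`.
  ∑-eulerSeries : ∀ q r {u v x} a (z : ℕ → Carrier) → (∀ i → u * z i ≈ u * x + v * fromℕ i) → ∀ N n →
    (∑[ i ≤ N ] (- 1#) ^ i * q ^ (a ℕ.* i) * eulerSeries r u (z i) n)
      ≈ (eulerSeries r u x ⊛ altExp (q ^ a) v N) n
  ∑-eulerSeries q r {u} {v} {x} a z uz≈ux+vi N n = begin
    (∑[ i ≤ N ] (- 1#) ^ i * q ^ (a ℕ.* i) * eulerSeries r u (z i) n)
      ≈⟨ (∑-cong N λ i _ → *-cong
           (trans (*-congˡ (sym (^-assocʳ q a i))) (-1^i*r^i≈[-r]^i (q ^ a) i))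
           (coefficient (≋-trans (eulerSeries-shift {r} {u} {x} (uz≈ux+vi i)) (⊛-comm 𝓔 (exp (v * fromℕ i)))) n)) ⟩
    (∑[ i ≤ N ] (- (q ^ a)) ^ i * (exp (v * fromℕ i) ⊛ 𝓔) n)
      ≈⟨ (∑-cong N λ i _ → coefficient (•-⊛ ((- (q ^ a)) ^ i) (exp (v * fromℕ i)) 𝓔) n) ⟨
    (∑[ i ≤ N ] (((- (q ^ a)) ^ i • exp (v * fromℕ i)) ⊛ 𝓔) n)
      ≈⟨ ∑-⊛ N (λ i → (- (q ^ a)) ^ i • exp (v * fromℕ i)) 𝓔 n ⟨
    ((λ j → ∑[ i ≤ N ] (- (q ^ a)) ^ i * exp (v * fromℕ i) j) ⊛ 𝓔) n
      ≈⟨ coefficient (⊛-cong (coefficientwise (altExp-expansion (q ^ a) v N)) (≋-refl {𝓔})) n ⟨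
    (altExp (q ^ a) v N ⊛ 𝓔) n
      ≈⟨ coefficient (⊛-comm (altExp (q ^ a) v N) 𝓔) n ⟩
    (𝓔 ⊛ altExp (q ^ a) v N) n ∎
    where 𝓔 = eulerSeries r u x

  ∑-E : ∀ q r {u v x} a (z : ℕ → Carrier) → (∀ i → u * z i ≈ u * x + v * fromℕ i) → ∀ N n →
    u ^ n * (∑[ i ≤ N ] (- 1#) ^ i * q ^ (a ℕ.* i) * E n r (z i))
      ≈ fromℕ (n !) * (eulerSeries r u x ⊛ altExp (q ^ a) v N) n
  ∑-E q r {u} {v} {x} a z uz≈ux+vi N n = begin
    u ^ n * (∑[ i ≤ N ] (- 1#) ^ i * q ^ (a ℕ.* i) * E n r (z i))
      ≈⟨ *-distribˡ-∑ N (u ^ n) (λ i → (- 1#) ^ i * q ^ (a ℕ.* i) * E n r (z i)) ⟩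
    (∑[ i ≤ N ] u ^ n * ((- 1#) ^ i * q ^ (a ℕ.* i) * E n r (z i)))
      ≈⟨ (∑-cong N λ i _ → solve 4 (λ a b c d → a :* (b :* (c :* d)) := c :* (b :* (a :* d))) refl
           (u ^ n) ((- 1#) ^ i * q ^ (a ℕ.* i)) (fromℕ (n !))
           (((fromℕ 2 • recip (denominator r 1#)) ⊛ exp (z i)) n)) ⟩
    (∑[ i ≤ N ] fromℕ (n !) * ((- 1#) ^ i * q ^ (a ℕ.* i) * eulerSeries r u (z i) n))
      ≈⟨ *-distribˡ-∑ N (fromℕ (n !)) (λ i → (- 1#) ^ i * q ^ (a ℕ.* i) * eulerSeries r u (z i) n) ⟨
    fromℕ (n !) * (∑[ i ≤ N ] (- 1#) ^ i * q ^ (a ℕ.* i) * eulerSeries r u (z i) n)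
      ≈⟨ *-congˡ (∑-eulerSeries q r a z uz≈ux+vi N n) ⟩
    fromℕ (n !) * (eulerSeries r u x ⊛ altExp (q ^ a) v N) n ∎

  -- The shift is made in two stages through `z i`: for fixed `i` the sum over `j` is `∑-E` based at
  -- `z i`, and the sum over `i` is then taken on whole series inside the product.
  ∑∑-E : ∀ q r {u v₁ v₂ x} a₁ a₂ (z : ℕ → Carrier) (z′ : ℕ → ℕ → Carrier) →
    (∀ i → u * z i ≈ u * x + v₁ * fromℕ i) → (∀ i j → u * z′ i j ≈ u * z i + v₂ * fromℕ j) → ∀ M N n →
    u ^ n * (∑[ i ≤ M ] ∑[ j ≤ N ] (- 1#) ^ (i ℕ.+ j) * q ^ (a₁ ℕ.* i ℕ.+ a₂ ℕ.* j) * E n r (z′ i j))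
      ≈ fromℕ (n !) * ((eulerSeries r u x ⊛ altExp (q ^ a₁) v₁ M) ⊛ altExp (q ^ a₂) v₂ N) n
  ∑∑-E q r {u} {v₁} {v₂} {x} a₁ a₂ z z′ uz≈ uz′≈ M N n = begin
    u ^ n * (∑[ i ≤ M ] ∑[ j ≤ N ] (- 1#) ^ (i ℕ.+ j) * q ^ (a₁ ℕ.* i ℕ.+ a₂ ℕ.* j) * E n r (z′ i j))
      ≈⟨ *-congˡ (∑-cong M λ i _ → trans
           (∑-cong N λ j _ → trans
             (*-congʳ (*-cong (^-homo-* (- 1#) i j) (^-homo-* q (a₁ ℕ.* i) (a₂ ℕ.* j))))
             (solve 5 (λ a b c d e → a :* b :* (c :* d) :* e := a :* c :* (b :* d :* e)) refl
               ((- 1#) ^ i) ((- 1#) ^ j) (q ^ (a₁ ℕ.* i)) (q ^ (a₂ ℕ.* j)) (E n r (z′ i j))))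
           (sym (*-distribˡ-∑ N (γ i) (λ j → (- 1#) ^ j * q ^ (a₂ ℕ.* j) * E n r (z′ i j))))) ⟩
    u ^ n * (∑[ i ≤ M ] γ i * (∑[ j ≤ N ] (- 1#) ^ j * q ^ (a₂ ℕ.* j) * E n r (z′ i j)))
      ≈⟨ *-distribˡ-∑ M (u ^ n) (λ i → γ i * (∑[ j ≤ N ] (- 1#) ^ j * q ^ (a₂ ℕ.* j) * E n r (z′ i j))) ⟩
    (∑[ i ≤ M ] u ^ n * (γ i * (∑[ j ≤ N ] (- 1#) ^ j * q ^ (a₂ ℕ.* j) * E n r (z′ i j))))
      ≈⟨ (∑-cong M λ i _ → begin
        u ^ n * (γ i * (∑[ j ≤ N ] (- 1#) ^ j * q ^ (a₂ ℕ.* j) * E n r (z′ i j)))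
          ≈⟨ x*yz≈y*xz (u ^ n) (γ i) _ ⟩
        γ i * (u ^ n * (∑[ j ≤ N ] (- 1#) ^ j * q ^ (a₂ ℕ.* j) * E n r (z′ i j)))
          ≈⟨ *-congˡ (∑-E q r a₂ (z′ i) (uz′≈ i) N n) ⟩
        γ i * (fromℕ (n !) * (eulerSeries r u (z i) ⊛ A) n)
          ≈⟨ x*yz≈y*xz (γ i) (fromℕ (n !)) _ ⟩
        fromℕ (n !) * (γ i * (eulerSeries r u (z i) ⊛ A) n)
          ≈⟨ *-congˡ (coefficient (•-⊛ (γ i) (eulerSeries r u (z i)) A) n) ⟨
        fromℕ (n !) * ((γ i • eulerSeries r u (z i)) ⊛ A) n ∎) ⟩
    (∑[ i ≤ M ] fromℕ (n !) * ((γ i • eulerSeries r u (z i)) ⊛ A) n)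
      ≈⟨ *-distribˡ-∑ M (fromℕ (n !)) (λ i → ((γ i • eulerSeries r u (z i)) ⊛ A) n) ⟨
    fromℕ (n !) * (∑[ i ≤ M ] ((γ i • eulerSeries r u (z i)) ⊛ A) n)
      ≈⟨ *-congˡ (∑-⊛ M (λ i → γ i • eulerSeries r u (z i)) A n) ⟨
    fromℕ (n !) * ((λ k → ∑[ i ≤ M ] γ i * eulerSeries r u (z i) k) ⊛ A) n
      ≈⟨ *-congˡ (coefficient (⊛-cong (coefficientwise (∑-eulerSeries q r a₁ z uz≈ M)) (≋-refl {A})) n) ⟩
    fromℕ (n !) * ((eulerSeries r u x ⊛ altExp (q ^ a₁) v₁ M) ⊛ A) n ∎
    where
    γ : ℕ → Carrier
    γ i = (- 1#) ^ i * q ^ (a₁ ℕ.* i)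
    A = altExp (q ^ a₂) v₂ N
    x*yz≈y*xz : ∀ a b c → a * (b * c) ≈ b * (a * c)
    x*yz≈y*xz = solve 3 (λ a b c → a :* (b :* c) := b :* (a :* c)) refl

  -- Inserting `l! * l! ⁻¹` and `m! * m! ⁻¹`, both equal to 1, completes `k!` to `d`. That `d` has
  -- nonzero magnitude follows because it is the image of a positive integer.
  1/[k!l!m!] : ∀ k l m → (fromℕ (k !) * fromℕ (l !) * fromℕ (m !)) ⁻¹ * fromℕ (k !)
                           ≈ fromℕ (l !) ⁻¹ * fromℕ (m !) ⁻¹
  1/[k!l!m!] k l m = begin
    d ⁻¹ * k!                                    ≈⟨ *-identityʳ _ ⟨
    d ⁻¹ * k! * 1#                               ≈⟨ *-congˡ (*-identityʳ 1#) ⟨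
    d ⁻¹ * k! * (1# * 1#)                        ≈⟨ *-congˡ (*-cong (n!*n!⁻¹≈1 l) (n!*n!⁻¹≈1 m)) ⟨
    d ⁻¹ * k! * (l! * l! ⁻¹ * (m! * m! ⁻¹))
      ≈⟨ solve 6 (λ i a b c d e → i :* a :* (b :* d :* (c :* e)) := a :* b :* c :* i :* (d :* e)) refl
           (d ⁻¹) k! l! m! (l! ⁻¹) (m! ⁻¹) ⟩
    d * d ⁻¹ * (l! ⁻¹ * m! ⁻¹)                   ≈⟨ *-congʳ d*d⁻¹≈1 ⟩
    1# * (l! ⁻¹ * m! ⁻¹)                         ≈⟨ *-identityˡ _ ⟩
    l! ⁻¹ * m! ⁻¹                                ∎
    where
    k! = fromℕ (k !)
    l! = fromℕ (l !)
    m! = fromℕ (m !)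
    d  = k! * l! * m!
    klm = k ! ℕ.* l ! ℕ.* m !
    fromℕ-klm : fromℕ klm ≈ d
    fromℕ-klm = trans (fromℕ-homo-* (k ! ℕ.* l !) (m !)) (*-congʳ (fromℕ-homo-* (k !) (l !)))
    klm≢0 : NonZero klm
    klm≢0 = ℕₚ.m*n≢0 (k ! ℕ.* l !) (m !) {{k ℕₚ.!* l !≢0}} {{m ℕₚ.!≢0}}
    d*d⁻¹≈1 : d * d ⁻¹ ≈ 1#
    d*d⁻¹≈1 = *-⁻¹ (λ ∣d∣≡𝟎 → ∣n∣≢𝟎 klm {{klm≢0}} (≡.trans (∣∣-cong fromℕ-klm) ∣d∣≡𝟎))

  -- The exponents `k + m` and `k + l` distribute as `(u * v) ^ k` for `E k`, `v ^ l` for `T l` and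
  -- `u ^ m` for `T m`, one scaling per factor. The factor `k !` inside `E` cancels against the
  -- multinomial.
  ∑-multinomial-E-T-T : ∀ r s₁ s₂ u v x M N n →
    ∑-triples n (λ k l m →
      multinomial n k l m * E k r x * T l s₁ M * T m s₂ N * u ^ (k ℕ.+ m) * v ^ (k ℕ.+ l))
      ≈ fromℕ (n !) * (eulerSeries r (u * v) x ⊛ (altExp s₁ v M ⊛ altExp s₂ u N)) n
  ∑-multinomial-E-T-T r s₁ s₂ u v x M N n = begin
    ∑-triples n (λ k l m →
      multinomial n k l m * E k r x * T l s₁ M * T m s₂ N * u ^ (k ℕ.+ m) * v ^ (k ℕ.+ l))
      ≈⟨ (∑-cong n λ k _ → begin
        (∑[ l ≤ n ∸ k ] (let m = n ∸ k ∸ l in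
          multinomial n k l m * E k r x * T l s₁ M * T m s₂ N * u ^ (k ℕ.+ m) * v ^ (k ℕ.+ l)))
          ≈⟨ (∑-cong (n ∸ k) λ l _ → term k l (n ∸ k ∸ l)) ⟩
        (∑[ l ≤ n ∸ k ] fromℕ (n !) * 𝓔 k * (A l * B (n ∸ k ∸ l)))
          ≈⟨ *-distribˡ-∑ (n ∸ k) (fromℕ (n !) * 𝓔 k) (λ l → A l * B (n ∸ k ∸ l)) ⟨
        fromℕ (n !) * 𝓔 k * (A ⊛ B) (n ∸ k)
          ≈⟨ *-assoc _ _ _ ⟩
        fromℕ (n !) * (𝓔 k * (A ⊛ B) (n ∸ k)) ∎) ⟩
    (∑[ k ≤ n ] fromℕ (n !) * (𝓔 k * (A ⊛ B) (n ∸ k)))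
      ≈⟨ *-distribˡ-∑ n (fromℕ (n !)) (λ k → 𝓔 k * (A ⊛ B) (n ∸ k)) ⟨
    fromℕ (n !) * (𝓔 ⊛ (A ⊛ B)) n ∎
    where
    𝓔 = eulerSeries r (u * v) x
    A = altExp s₁ v M
    B = altExp s₂ u N
    e = (fromℕ 2 • recip (denominator r 1#)) ⊛ exp x
    term : ∀ k l m →
      multinomial n k l m * E k r x * T l s₁ M * T m s₂ N * u ^ (k ℕ.+ m) * v ^ (k ℕ.+ l)
        ≈ fromℕ (n !) * 𝓔 k * (A l * B m)
    term k l m = begin
      fromℕ (n !) * d⁻¹ * (fromℕ (k !) * e k) * T l s₁ M * T m s₂ N * u ^ (k ℕ.+ m) * v ^ (k ℕ.+ l)
        ≈⟨ *-cong (*-congˡ (^-homo-* u k m)) (^-homo-* v k l) ⟩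
      fromℕ (n !) * d⁻¹ * (fromℕ (k !) * e k) * T l s₁ M * T m s₂ N * (u ^ k * u ^ m) * (v ^ k * v ^ l)
        ≈⟨ solve 10 (λ a i b c s t x y z w →
             a :* i :* (b :* c) :* s :* t :* (x :* y) :* (z :* w)
               := a :* (x :* z :* c) :* (s :* w :* (t :* y)) :* (i :* b)) refl
             (fromℕ (n !)) d⁻¹ (fromℕ (k !)) (e k) (T l s₁ M) (T m s₂ N) (u ^ k) (u ^ m) (v ^ k) (v ^ l) ⟩
      fromℕ (n !) * (u ^ k * v ^ k * e k) * (T l s₁ M * v ^ l * (T m s₂ N * u ^ m)) * (d⁻¹ * fromℕ (k !))
        ≈⟨ *-cong (*-congʳ (*-congˡ (*-congʳ (sym (^-distrib-* u v k))))) (1/[k!l!m!] k l m) ⟩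
      fromℕ (n !) * 𝓔 k * (T l s₁ M * v ^ l * (T m s₂ N * u ^ m)) * (fromℕ (l !) ⁻¹ * fromℕ (m !) ⁻¹)
        ≈⟨ solve 5 (λ a b c i j → a :* (b :* c) :* (i :* j) := a :* (b :* i :* (c :* j))) refl
             (fromℕ (n !) * 𝓔 k) (T l s₁ M * v ^ l) (T m s₂ N * u ^ m) (fromℕ (l !) ⁻¹) (fromℕ (m !) ⁻¹) ⟩
      fromℕ (n !) * 𝓔 k * (A l * B m) ∎
      where d⁻¹ = (fromℕ (k !) * fromℕ (l !) * fromℕ (m !)) ⁻¹

  u*[y+v/u*z] : ∀ {u} v y z → u * u ⁻¹ ≈ 1# → u * (y + v / u * z) ≈ u * y + v * z
  u*[y+v/u*z] {u} v y z uu⁻¹≈1 = begin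
    u * (y + v * u ⁻¹ * z)
      ≈⟨ solve 5 (λ u v i y z → u :* (y :+ v :* i :* z) := u :* y :+ (u :* i) :* (v :* z)) refl u v (u ⁻¹) y z ⟩
    u * y + u * u ⁻¹ * (v * z)  ≈⟨ +-congˡ (trans (*-congʳ uu⁻¹≈1) (*-identityˡ _)) ⟩
    u * y + v * z               ∎

  u*v*[y+z/u] : ∀ {u} v y z → u * u ⁻¹ ≈ 1# → u * v * (y + z / u) ≈ u * v * y + v * z
  u*v*[y+z/u] {u} v y z uu⁻¹≈1 = begin
    u * v * (y + z * u ⁻¹)
      ≈⟨ solve 5 (λ u v i y z → u :* v :* (y :+ z :* i) := u :* v :* y :+ (u :* i) :* (v :* z)) refl u v (u ⁻¹) y z ⟩
    u * v * y + u * u ⁻¹ * (v * z)  ≈⟨ +-congˡ (trans (*-congʳ uu⁻¹≈1) (*-identityˡ _)) ⟩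
    u * v * y + v * z               ∎

-- Magnitudes and the p-adic absolute value of rationals.

<ᴹ-irrefl : ∀ {m} → ¬ (m <ᴹ m)
<ᴹ-irrefl [ r<r ] = ℚₚ.<-irrefl ≡.refl r<r

radius<1 : ∀ p .{{_ : NonTrivial p}} → radius p <ᴹ p^ 0ℚ
radius<1 (2+ k) = [ ℚₚ.negative⁻¹ _ {{ℚₚ.neg-pos {ℚ.normalize 1 (suc k)} (ℚₚ.normalize-pos 1 (suc k))}} ]

<ᴹ-trans : ∀ {l m n} → l <ᴹ m → m <ᴹ n → l <ᴹ n
<ᴹ-trans = AddInfimum<.<₋-trans ℚ._<_ ℚₚ.<-trans

≤ᴹ-<ᴹ-trans : ∀ {l m n} → l ≤ᴹ m → m <ᴹ n → l <ᴹ n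
≤ᴹ-<ᴹ-trans = AddInfimum<.<₋-transʳ ℚ._<_ ℚₚ.≤-<-trans

⊔ᴹ-<1 : ∀ {m n} → m <ᴹ p^ 0ℚ → n <ᴹ p^ 0ℚ → m ⊔ᴹ n <ᴹ p^ 0ℚ
⊔ᴹ-<1 {𝟎}    {_}    _       n<1     = n<1
⊔ᴹ-<1 {p^ _} {𝟎}    m<1     _       = m<1
⊔ᴹ-<1 {p^ r} {p^ s} m<1 n<1 with ℚₚ.⊔-sel r s
... | inj₁ r⊔s≡r = ≡.subst (λ t → p^ t <ᴹ p^ 0ℚ) (≡.sym r⊔s≡r) m<1
... | inj₂ r⊔s≡s = ≡.subst (λ t → p^ t <ᴹ p^ 0ℚ) (≡.sym r⊔s≡s) n<1

·ᴹ-<1 : ∀ {m n} → m <ᴹ p^ 0ℚ → n <ᴹ p^ 0ℚ → m ·ᴹ n <ᴹ p^ 0ℚ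
·ᴹ-<1 {𝟎}    {_}    m<1     _       = m<1
·ᴹ-<1 {p^ _} {𝟎}    _       n<1     = n<1
·ᴹ-<1 {p^ _} {p^ _} [ r<0 ] [ s<0 ] = [ ℚₚ.+-mono-< r<0 s<0 ]

maxPower≡0 : ∀ p n b → (∀ k → ¬ p ℕ.^ suc k ∣ n) → maxPower p n b ≡ 0
maxPower≡0 p n zero    _ = ≡.refl
maxPower≡0 p n (suc b) ∤n rewrite dec-false (p ℕ.^ suc b ∣? n) (∤n b) =
  maxPower≡0 p n b ∤n

-- A positive power of `p` dividing `n` would make `p` itself divide the smaller positive number
-- `n`.
n<p⇒ord≡0 : ∀ {p} n .{{_ : NonZero n}} → n < p → ord p n ≡ 0
n<p⇒ord≡0 {p} n n<p = maxPower≡0 p n n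
  λ k p^[1+k]∣n → >⇒∤ n<p (∣-trans (m∣m*n (p ℕ.^ k)) p^[1+k]∣n)

∣-2∣≡1 : ∀ {p} → 2 < p → padicAbs p (ℚ.- (1ℚ ℚ.+ 1ℚ)) ≡ p^ 0ℚ
-- The rational computes to numerator -2 and denominator 1, so only `ord p 1` and `ord p 2` remain
-- to be evaluated.
∣-2∣≡1 {p} 2<p rewrite n<p⇒ord≡0 {p} 1 (ℕₚ.<-trans (ℕ.s≤s (ℕ.s≤s ℕ.z≤n)) 2<p) | n<p⇒ord≡0 {p} 2 2<p = ≡.refl

positive⇒∣∣≢𝟎 : ∀ p x → ℚ.Positive x → padicAbs p x ≢ 𝟎
positive⇒∣∣≢𝟎 p (mkℚ ℤ.+[1+ _ ] _ _) _ ()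

open RawMonoidDefs ℚ.+-0-rawMonoid using () renaming (_×_ to _×ℚ_)

nonNegative-×1ℚ : ∀ n → ℚ.NonNegative (n ×ℚ 1ℚ)
nonNegative-×1ℚ zero    = _
nonNegative-×1ℚ (suc n) = ℚₚ.nonNeg+nonNeg⇒nonNeg 1ℚ (n ×ℚ 1ℚ) {{nonNegative-×1ℚ n}}

oddPrime>2 : ∀ {p} → Prime p → Odd p → 2 < p
oddPrime>2 {0} p-prime _   = contradiction p-prime ¬prime[0]
oddPrime>2 {1} p-prime _   = contradiction p-prime ¬prime[1]
oddPrime>2 {2} _       odd = contradiction ∣-refl odd
oddPrime>2 {suc (2+ p)} _ _ = ℕ.s≤s (ℕ.s≤s (ℕ.s≤s ℕ.z≤n))

-- Nonvanishing in `ℂₚ`, transported from the rationals.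

module PAdicEstimates {c ℓ₁ ℓ₂} {p : ℕ} (𝒞 : PAdicComplexNumbers p c ℓ₁ ℓ₂) where

  open PAdicComplexNumbers 𝒞
  open ValuedField ℂₚ hiding (zero)
  open Euler ℂₚ
  open CommutativeRing commutativeRing using (ring)
  open RingProperties ring
  open SetoidReasoning setoid
  private
    module ℚₚ-isCompletion = IsCompletion ℚₚ-isCompletion
    module ℚ̄ₚ-isAlgebraicClosure = IsAlgebraicClosure ℚ̄ₚ-isAlgebraicClosure
    module ℂₚ-isCompletion = IsCompletion ℂₚ-isCompletion

  ι : ℚ → Carrier
  ι = ι₃ ∘ ι₂ ∘ ι₁

  ι-homomorphic : IsRingHomomorphism ℚ.+-*-rawRing rawRing ι
  ι-homomorphic = isRingHomomorphism trans
    (isRingHomomorphism (ValuedField.trans ℚ̄ₚ)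
      ℚₚ-isCompletion.homomorphic ℚ̄ₚ-isAlgebraicClosure.homomorphic)
    ℂₚ-isCompletion.homomorphic

  open IsRingHomomorphism ι-homomorphic using (+-homo; -‿homo; 0#-homo; 1#-homo)

  ι-isometric : ∀ x → ∣ ι x ∣ ≡ padicAbs p x
  ι-isometric x = ≡.trans (ℂₚ-isCompletion.isometric (ι₂ (ι₁ x)))
    (≡.trans (ℚ̄ₚ-isAlgebraicClosure.isometric (ι₁ x)) (ℚₚ-isCompletion.isometric x))

  ι-×1 : ∀ n → ι (n ×ℚ 1ℚ) ≈ fromℕ n
  ι-×1 zero    = 0#-homo
  ι-×1 (suc n) = trans (+-homo 1ℚ (n ×ℚ 1ℚ)) (+-cong 1#-homo (ι-×1 n))

  -- The image of `n` is that of the iterated sum `n ×ℚ 1ℚ`, and `ι` is isometric. A positive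
  -- rational has a positive numerator, where `padicAbs` is a power of p.
  characteristicZero : CharacteristicZero ℂₚ
  characteristicZero (suc n) ∣1+n∣≡𝟎 = positive⇒∣∣≢𝟎 p (suc n ×ℚ 1ℚ)
    (ℚₚ.pos+nonNeg⇒pos 1ℚ (n ×ℚ 1ℚ) {{nonNegative-×1ℚ n}})
    (≡.trans (≡.sym (ι-isometric (suc n ×ℚ 1ℚ))) (≡.trans (∣∣-cong (ι-×1 (suc n))) ∣1+n∣≡𝟎))

  ∣∣≡𝟎⇒≈0 : ∀ {x} → ∣ x ∣ ≡ 𝟎 → x ≈ 0#
  ∣∣≡𝟎⇒≈0 {x} ∣x∣≡𝟎 = proj₁ (tight x 0#) (λ x#0 → proj₂ definite x#0 ∣x∣≡𝟎)

  -- xy - 1 = (x - 1)(y - 1) + (x - 1) + (y - 1)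
  ∣q^w-1∣<1 : ∀ {q} → ∣ q - 1# ∣ <ᴹ p^ 0ℚ → ∀ w → ∣ q ^ w - 1# ∣ <ᴹ p^ 0ℚ
  ∣q^w-1∣<1 {q} ∣q-1∣<1 zero = ≡.subst (_<ᴹ p^ 0ℚ) (≡.sym ∣1-1∣≡𝟎) ⊥₋<[ 0ℚ ]
    where
    ∣1-1∣≡𝟎 : ∣ 1# - 1# ∣ ≡ 𝟎
    -- The magnitude of zero is read off in `ℚ`, where `padicAbs p 0ℚ` computes to `𝟎`.
    ∣1-1∣≡𝟎 = ≡.trans (∣∣-cong (trans (-‿inverseʳ 1#) (sym 0#-homo))) (ι-isometric 0ℚ)
  ∣q^w-1∣<1 {q} ∣q-1∣<1 (suc w) = ≡.subst (_<ᴹ p^ 0ℚ) (∣∣-cong (sym q*q^w-1))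
    (≤ᴹ-<ᴹ-trans (ultrametric ((q - 1#) * (q ^ w - 1#) + (q - 1#)) (q ^ w - 1#)) (⊔ᴹ-<1
      (≤ᴹ-<ᴹ-trans (ultrametric ((q - 1#) * (q ^ w - 1#)) (q - 1#)) (⊔ᴹ-<1
        (≡.subst (_<ᴹ p^ 0ℚ) (≡.sym (∣∣-* (q - 1#) (q ^ w - 1#))) (·ᴹ-<1 ∣q-1∣<1 IH))
        ∣q-1∣<1))
      IH))
    where
    IH = ∣q^w-1∣<1 ∣q-1∣<1 w
    x-1+1 : ∀ x → x - 1# + 1# ≈ x
    x-1+1 x = trans (+-assoc x (- 1#) 1#) (trans (+-congˡ (-‿inverseˡ 1#)) (+-identityʳ x))
    q*q^w-1 : q * q ^ w - 1# ≈ (q - 1#) * (q ^ w - 1#) + (q - 1#) + (q ^ w - 1#)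
    q*q^w-1 = begin
      q * q ^ w - 1#
        ≈⟨ +-congʳ (*-congʳ (x-1+1 q)) ⟨
      (q - 1# + 1#) * q ^ w - 1#
        ≈⟨ +-congʳ (distribʳ (q ^ w) (q - 1#) 1#) ⟩
      (q - 1#) * q ^ w + 1# * q ^ w - 1#
        ≈⟨ +-congʳ (+-cong (*-congˡ (sym (x-1+1 (q ^ w)))) (*-identityˡ (q ^ w))) ⟩
      (q - 1#) * (q ^ w - 1# + 1#) + q ^ w - 1#
        ≈⟨ +-assoc _ (q ^ w) (- 1#) ⟩
      (q - 1#) * (q ^ w - 1# + 1#) + (q ^ w - 1#)
        ≈⟨ +-congʳ (trans (distribˡ (q - 1#) (q ^ w - 1#) 1#) (+-congˡ (*-identityʳ (q - 1#)))) ⟩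
      (q - 1#) * (q ^ w - 1#) + (q - 1#) + (q ^ w - 1#) ∎

  -- r = -1 would give |r - 1| = |-2| = 1, because p is odd.
  ∣r+1∣≢𝟎 : 2 < p → ∀ {r} → ∣ r - 1# ∣ <ᴹ p^ 0ℚ → ∣ r + 1# ∣ ≢ 𝟎
  ∣r+1∣≢𝟎 2<p {r} ∣r-1∣<1 ∣r+1∣≡𝟎 =
    <ᴹ-irrefl (≡.subst (_<ᴹ p^ 0ℚ) ∣r-1∣≡1 ∣r-1∣<1)
    where
    r-1≈-2 : r - 1# ≈ ι (ℚ.- (1ℚ ℚ.+ 1ℚ))
    r-1≈-2 = begin
      r - 1#                     ≈⟨ +-congʳ (+-inverseˡ-unique r 1# (∣∣≡𝟎⇒≈0 ∣r+1∣≡𝟎)) ⟩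
      - 1# - 1#                  ≈⟨ -‿+-comm 1# 1# ⟩
      - (1# + 1#)                ≈⟨ -‿cong (+-cong 1#-homo 1#-homo) ⟨
      - (ι 1ℚ + ι 1ℚ)            ≈⟨ -‿cong (+-homo 1ℚ 1ℚ) ⟨
      - ι (1ℚ ℚ.+ 1ℚ)            ≈⟨ -‿homo (1ℚ ℚ.+ 1ℚ) ⟨
      ι (ℚ.- (1ℚ ℚ.+ 1ℚ))        ∎
    ∣r-1∣≡1 : ∣ r - 1# ∣ ≡ p^ 0ℚ
    ∣r-1∣≡1 = ≡.trans (∣∣-cong r-1≈-2) (≡.trans (ι-isometric _) (∣-2∣≡1 2<p))

-- Comparison of the eight expressions with one coefficient.

mainTheorem1 : ∀ {c ℓ₁ ℓ₂} (p : ℕ) (p-prime : Prime p) → Odd p →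
  (𝒞 : PAdicComplexNumbers p c ℓ₁ ℓ₂) →
  let open PAdicComplexNumbers 𝒞
      open ValuedField ℂₚ
      open Euler ℂₚ
  in
  (q : Carrier) → ∣ q - 1# ∣ <ᴹ radius p {{prime⇒nonTrivial p-prime}} →
  (w₁ w₂ : ℕ) → Odd w₁ → Odd w₂ → (n : ℕ) → (y₁ : ℤₚ) →
  let y  = fromℤₚ y₁
      W₁ = fromℕ w₁
      W₂ = fromℕ w₂
  in
  AllPairs _≈_
    ( (∑[ k ≤ n ] fromℕ (n C k) * E k (q ^ w₂) (W₁ * y) * T (n ∸ k) (q ^ w₁) (w₂ ∸ 1) * W₁ ^ (n ∸ k) * W₂ ^ k)
    ∷ (∑[ k ≤ n ] fromℕ (n C k) * E k (q ^ w₁) (W₂ * y) * T (n ∸ k) (q ^ w₂) (w₁ ∸ 1) * W₂ ^ (n ∸ k) * W₁ ^ k)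
    ∷ W₁ ^ n * (∑[ i ≤ w₁ ∸ 1 ] (- 1#) ^ i * q ^ (w₂ ℕ.* i) * E n (q ^ w₁) (W₂ * y + W₂ / W₁ * fromℕ i))
    ∷ W₂ ^ n * (∑[ i ≤ w₂ ∸ 1 ] (- 1#) ^ i * q ^ (w₁ ℕ.* i) * E n (q ^ w₂) (W₁ * y + W₁ / W₂ * fromℕ i))
    ∷ ∑-triples n (λ k l m →
        multinomial n k l m * E k (q ^ (w₁ ℕ.* w₂)) y * T l (q ^ w₂) (w₁ ∸ 1) * T m (q ^ w₁) (w₂ ∸ 1)
          * W₁ ^ (k ℕ.+ m) * W₂ ^ (k ℕ.+ l))
    ∷ W₁ ^ n * (∑[ k ≤ n ] fromℕ (n C k) * T (n ∸ k) (q ^ w₁) (w₂ ∸ 1) * W₂ ^ k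
        * (∑[ i ≤ w₁ ∸ 1 ] (- 1#) ^ i * q ^ (w₂ ℕ.* i) * E k (q ^ (w₁ ℕ.* w₂)) (y + fromℕ i / W₁)))
    ∷ W₂ ^ n * (∑[ k ≤ n ] fromℕ (n C k) * T (n ∸ k) (q ^ w₂) (w₁ ∸ 1) * W₁ ^ k
        * (∑[ i ≤ w₂ ∸ 1 ] (- 1#) ^ i * q ^ (w₁ ℕ.* i) * E k (q ^ (w₁ ℕ.* w₂)) (y + fromℕ i / W₂)))
    ∷ (W₁ * W₂) ^ n * (∑[ i ≤ w₁ ∸ 1 ] ∑[ j ≤ w₂ ∸ 1 ]
        (- 1#) ^ (i ℕ.+ j) * q ^ (w₂ ℕ.* i ℕ.+ w₁ ℕ.* j)
          * E n (q ^ (w₁ ℕ.* w₂)) (y + fromℕ i / W₁ + fromℕ j / W₂))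
    ∷ [] )
mainTheorem1 p p-prime p-odd 𝒞 q ∣q-1∣<radius w₁ w₂ w₁-odd w₂-odd n y₁ =
  -- With `S₁` bracketed first, expressions in which `S₁` is absorbed or expanded first match
  -- directly; those starting from `S₂` pass through `swap`.
  all≈⇒allPairs setoid {x = fromℕ (n !) * ((𝓔 ⊛ S₁) ⊛ S₂) n}
    ( trans (∑-binomial-E-T (q ^ w₂) (q ^ w₁) W₂ W₁ (W₁ * y) (w₂ ∸ 1) n) 𝓔₂S₂
    ∷ trans (∑-binomial-E-T (q ^ w₁) (q ^ w₂) W₁ W₂ (W₂ * y) (w₁ ∸ 1) n) 𝓔₁S₁
    ∷ trans (∑-E q (q ^ w₁) w₂ _ (λ i → u*[y+v/u*z] W₂ (W₂ * y) (fromℕ i) W₁W₁⁻¹≈1) (w₁ ∸ 1) n) 𝓔₁S₁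
    ∷ trans (∑-E q (q ^ w₂) w₁ _ (λ i → u*[y+v/u*z] W₁ (W₁ * y) (fromℕ i) W₂W₂⁻¹≈1) (w₂ ∸ 1) n) 𝓔₂S₂
    ∷ trans (∑-multinomial-E-T-T q₁₂ (q ^ w₂) (q ^ w₁) W₁ W₂ y (w₁ ∸ 1) (w₂ ∸ 1) n)
        (n!-congˡ (≋-sym (⊛-assoc 𝓔 S₁ S₂)))
    ∷ ∑-binomial-T (q ^ w₁) W₂ W₁ (w₂ ∸ 1) _ (𝓔 ⊛ S₁)
        (λ k → ∑-E q q₁₂ w₂ _ shift₁ (w₁ ∸ 1) k) n
    ∷ trans (∑-binomial-T (q ^ w₂) W₁ W₂ (w₁ ∸ 1) _ (𝓔 ⊛ S₂)
        -- With the roles of the weights exchanged, `∑-binomial-T` produces `(W₂ * W₁) ^ k`, while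
        -- `𝓔` is scaled by `W₁ * W₂`.
        (λ k → trans (*-congʳ (^-congˡ k (*-comm W₂ W₁))) (∑-E q q₁₂ w₁ _ (shift₂ y) (w₂ ∸ 1) k)) n)
        (n!-congˡ swap)
    ∷ ∑∑-E q q₁₂ w₂ w₁ _ _ shift₁ (λ i → shift₂ (y + fromℕ i / W₁)) (w₁ ∸ 1) (w₂ ∸ 1) n
    ∷ [] )
  where
  open PAdicComplexNumbers 𝒞
  open ValuedField ℂₚ hiding (zero)
  open Euler ℂₚ
  open PAdicEstimates 𝒞
  open FormalSeries ℂₚ
  open ExponentialSeries ℂₚ characteristicZero
  open EulerSeries ℂₚ characteristicZero
  open EulerIdentities ℂₚ characteristicZero
  open CommutativeRing commutativeRing using (commutativeSemiring)
  open Exp commutativeSemiring using (^-congˡ; ^-assocʳ)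
  open CommutativeSemigroupProperties 𝕊.*-commutativeSemigroup using (xy∙z≈xz∙y)

  y   = fromℤₚ y₁
  W₁  = fromℕ w₁
  W₂  = fromℕ w₂
  q₁₂ = q ^ (w₁ ℕ.* w₂)
  𝓔   = eulerSeries q₁₂ (W₁ * W₂) y
  S₁  = altExp (q ^ w₂) W₂ (w₁ ∸ 1)
  S₂  = altExp (q ^ w₁) W₁ (w₂ ∸ 1)

  ∣q^w+1∣≢𝟎 : ∀ w → ∣ q ^ w + 1# ∣ ≢ 𝟎
  ∣q^w+1∣≢𝟎 w = ∣r+1∣≢𝟎 (oddPrime>2 p-prime p-odd)
    (∣q^w-1∣<1 (<ᴹ-trans ∣q-1∣<radius (radius<1 p {{prime⇒nonTrivial p-prime}})) w)

  odd⇒W*W⁻¹≈1 : ∀ w → Odd w → fromℕ w * fromℕ w ⁻¹ ≈ 1#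
  odd⇒W*W⁻¹≈1 zero    odd = contradiction (2 ∣0) odd
  odd⇒W*W⁻¹≈1 (suc w) _   = *-⁻¹ (characteristicZero (suc w))

  W₁W₁⁻¹≈1 = odd⇒W*W⁻¹≈1 w₁ w₁-odd
  W₂W₂⁻¹≈1 = odd⇒W*W⁻¹≈1 w₂ w₂-odd

  shift₁ : ∀ i → W₁ * W₂ * (y + fromℕ i / W₁) ≈ W₁ * W₂ * y + W₂ * fromℕ i
  shift₁ i = u*v*[y+z/u] W₂ y (fromℕ i) W₁W₁⁻¹≈1

  shift₂ : ∀ x j → W₁ * W₂ * (x + fromℕ j / W₂) ≈ W₁ * W₂ * x + W₁ * fromℕ j
  shift₂ x j = trans (*-congʳ (*-comm W₁ W₂))
    (trans (u*v*[y+z/u] W₁ x (fromℕ j) W₂W₂⁻¹≈1) (+-congʳ (*-congʳ (*-comm W₂ W₁))))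

  n!-congˡ : ∀ {f g} → f ≋ g → fromℕ (n !) * f n ≈ fromℕ (n !) * g n
  n!-congˡ f≋g = *-congˡ (coefficient f≋g n)

  swap : (𝓔 ⊛ S₂) ⊛ S₁ ≋ (𝓔 ⊛ S₁) ⊛ S₂
  swap = xy∙z≈xz∙y 𝓔 S₂ S₁

  -- The series for `q ^ w₂` is `𝓔` with `S₁` absorbed: raising `q ^ w₂` to the power `w₁` gives
  -- `q₁₂`, and `W₂ * (W₁ * y)` is the exponent `W₁ * W₂ * y` of `𝓔`.
  𝓔₂S₂ : fromℕ (n !) * (eulerSeries (q ^ w₂) W₂ (W₁ * y) ⊛ S₂) n ≈ fromℕ (n !) * ((𝓔 ⊛ S₁) ⊛ S₂) n
  𝓔₂S₂ = n!-congˡ (⊛-cong (eulerSeries-reduce w₁ w₁-odd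
    (trans (reflexive (≡.cong (q ^_) (ℕₚ.*-comm w₁ w₂))) (sym (^-assocʳ q w₂ w₁)))
    (*-comm W₁ W₂)
    (trans (sym (*-assoc W₂ W₁ y)) (*-congʳ (*-comm W₂ W₁)))
    (∣q^w+1∣≢𝟎 w₂) (∣q^w+1∣≢𝟎 (w₁ ℕ.* w₂))) (≋-refl {S₂}))

  𝓔₁S₁ : fromℕ (n !) * (eulerSeries (q ^ w₁) W₁ (W₂ * y) ⊛ S₁) n ≈ fromℕ (n !) * ((𝓔 ⊛ S₁) ⊛ S₂) n
  𝓔₁S₁ = n!-congˡ (≋-trans (⊛-cong (eulerSeries-reduce w₂ w₂-odd
    (sym (^-assocʳ q w₁ w₂)) refl (sym (*-assoc W₁ W₂ y))
    (∣q^w+1∣≢𝟎 w₁) (∣q^w+1∣≢𝟎 (w₁ ℕ.* w₂))) (≋-refl {S₁})) swap)
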